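{- Let $\Lambda_f$ be a uniformly random numerical semigroup with Frobenius number $f$, and $m(\Lambda_f)$ its multiplicity. Then for every integer $k$: \[\lim_{f\to\infty,\ f \text{ even}} \mathbb{P}[f - 2m(\Lambda_f) = 2k] = \begin{cases} C_0^{ -1} 2^{k-1} & k < 0,\\ 0 & k = 0,\\ C_0^{ -1} 2^{ -3k-1} S(2k) & k > 0;\end{cases}\] \[\lim_{f\to\infty,\ f \text{ odd}} \mathbb{P}[f - 2m(\Lambda_f) = 2k+1] = \begin{cases} C_1^{ -1} 2^{(2k-1)/2} & k < 0,\\ C_1^{ -1} 2^{ -(6k+5)/2} S(2k+1) & k \geq 0.\end{cases}\]
   Context: A numerical semigroup is a subset $\Lambda \subseteq \mathbb{N}_0$ containing $0$, closed under addition, with finite complement; its multiplicity is $\min(\Lambda\setminus\{0\})$, its conductor is the least $c$ with $c + \mathbb{N}_0 \subseteq \Lambda$, and its Frobenius number is the conductor minus $1$. $\operatorname{Fr}(f)$ denotes the number of numerical semigroups with Frobenius number $f$, and $C_0 = \lim_{f\ \text{even}} 2^{ -f/2}\operatorname{Fr}(f)$, $C_1 = \lim_{f\ \text{odd}} 2^{ -f/2}\operatorname{Fr}(f)$ (these limits exist and are positive constants, by Backelin). For $j \geq 1$, $S(j)$ is the number of numerical semigroups with multiplicity $j+1$ and Frobenius number $3j+2$. -}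

module Defs where

open import Data.Bool.Base using (Bool; true; false; T; if_then_else_)
open import Data.Bool.Properties using (T?)
open import Data.Integer.Base as ℤ using (ℤ; +_; -[1+_]; +[1+_]; +0)
import Data.Integer.Properties as ℤ
open import Data.List.Base using (List; []; _∷_; _++_; map; mapMaybe; filter; length)
open import Data.List.Membership.Propositional using (_∈_)
open import Data.List.Membership.Propositional.Properties using (∈-map⁺; ∈-map⁻; ∈-++⁺ˡ; ∈-++⁺ʳ; ∈-filter⁺; ∈-filter⁻)
open import Data.List.Relation.Unary.All using (All; []; _∷_)
open import Data.List.Relation.Unary.AllPairs using (AllPairs; []; _∷_)
import Data.List.Relation.Unary.AllPairs.Properties as AllPairs
open import Data.List.Relation.Unary.Any using (here; there)
open import Data.List.Relation.Unary.Unique.Propositional using (Unique)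
import Data.List.Relation.Unary.Unique.Propositional.Properties as Unique
open import Data.Maybe.Base using (Maybe; just; nothing)
open import Data.Nat.Base as ℕ using (ℕ; zero; suc; z≤n; s≤s)
import Data.Nat.Properties as ℕ
open import Data.Product.Base using (∃; _×_; _,_; proj₁; proj₂)
open import Data.Rational.Base as ℚ using (ℚ; 0ℚ; 1ℚ; ½; mkℚ)
import Data.Rational.Properties as ℚ
import Data.Rational.Unnormalised.Base as ℚᵘ
import Data.Rational.Unnormalised.Properties as ℚᵘ
open import Data.Rational.Solver using (module +-*-Solver)
open import Data.Sum.Base using (inj₁; inj₂)
open import Data.Unit.Base using (tt)
open import Data.Vec.Base using (Vec; []; _∷_; tabulate)
open import Data.Fin.Base using (toℕ)
open import Function.Base using (_∘_)
open import Level using (0ℓ)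
open import Relation.Binary.PropositionalEquality
open import Relation.Nullary using (¬_; Dec; yes; no; contradiction)
open import Relation.Nullary.Decidable using (map′; _×-dec_; _→-dec_)
open import Relation.Unary using (Pred; Decidable)

-- A cofinite set is classically decidable, hence given by its characteristic
-- function; equality of semigroups is _≐_.
record NumericalSemigroup : Set where
  field
    member   : ℕ → Bool
    0∈       : T (member 0)
    +-closed : ∀ m n → T (member m) → T (member n) → T (member (m ℕ.+ n))
    cofinite : ∃ λ N → ∀ n → N ℕ.≤ n → T (member n)

open NumericalSemigroup public

infix 4 _∈ₛ_ _≐_

_∈ₛ_ : ℕ → NumericalSemigroup → Set
n ∈ₛ Λ = T (member Λ n)

_≐_ : NumericalSemigroup → NumericalSemigroup → Set
Λ ≐ Λ′ = ∀ n → member Λ n ≡ member Λ′ n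

IsMultiplicity : NumericalSemigroup → ℕ → Set
IsMultiplicity Λ m = (m ∈ₛ Λ × m ≢ 0) × (∀ n → n ∈ₛ Λ → n ≢ 0 → m ℕ.≤ n)

IsConductor : NumericalSemigroup → ℕ → Set
IsConductor Λ c = (∀ n → c ℕ.+ n ∈ₛ Λ) × (∀ d → (∀ n → d ℕ.+ n ∈ₛ Λ) → c ℕ.≤ d)

-- The least n with T (p n), provided T (p N).
least : (p : ℕ → Bool) (N : ℕ) → ℕ
least p zero    = zero
least p (suc N) = if p zero then zero else suc (least (p ∘ suc) N)

-- The least c with T (p n) for all n ≥ c, provided T (p n) for all n ≥ N.
leastTail : (p : ℕ → Bool) (N : ℕ) → ℕ
leastTail p zero    = zero
leastTail p (suc N) = if p N then leastTail p N else suc N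

-- multiplicity-correct and conductor-correct below relate these functions to
-- IsMultiplicity and IsConductor.
multiplicity : NumericalSemigroup → ℕ
multiplicity Λ = suc (least (member Λ ∘ suc) (proj₁ (cofinite Λ)))

conductor : NumericalSemigroup → ℕ
conductor Λ = leastTail (member Λ) (proj₁ (cofinite Λ))

frobenius : NumericalSemigroup → ℤ
frobenius Λ = + conductor Λ ℤ.- + 1

least-true : ∀ (p : ℕ → Bool) N → T (p N) → T (p (least p N))
least-true p zero    pN = pN
least-true p (suc N) pN with p zero in eq
... | true  = subst T (sym eq) tt
... | false = least-true (p ∘ suc) N pN

least-min : ∀ (p : ℕ → Bool) N n → T (p n) → least p N ℕ.≤ n
least-min p zero    n pn = z≤n
least-min p (suc N) n pn with p zero in eq
least-min p (suc N) n pn       | true  = z≤n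
least-min p (suc N) zero pn    | false = contradiction (subst T eq pn) (λ ())
least-min p (suc N) (suc n) pn | false = s≤s (least-min (p ∘ suc) N n pn)

multiplicity-correct : ∀ Λ → IsMultiplicity Λ (multiplicity Λ)
multiplicity-correct Λ =
  (least-true p N (proj₂ (cofinite Λ) (suc N) (ℕ.n≤1+n N)) , λ ()) , minimal
  where
  N = proj₁ (cofinite Λ)
  p = member Λ ∘ suc
  minimal : ∀ n → n ∈ₛ Λ → n ≢ 0 → multiplicity Λ ℕ.≤ n
  minimal zero    _ n≢0 = contradiction refl n≢0
  minimal (suc n) pn _  = s≤s (least-min p N n pn)

leastTail-true : ∀ (p : ℕ → Bool) N → (∀ n → N ℕ.≤ n → T (p n)) → ∀ n → leastTail p N ℕ.≤ n → T (p n)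
leastTail-true p zero    h n le = h n le
leastTail-true p (suc N) h n le with p N in eq
... | false = h n le
... | true  = leastTail-true p N h′ n le
  where
  h′ : ∀ n → N ℕ.≤ n → T (p n)
  h′ n N≤n with ℕ.m≤n⇒m<n∨m≡n N≤n
  ... | inj₁ N<n  = h n N<n
  ... | inj₂ refl = subst T (sym eq) tt

leastTail-min : ∀ (p : ℕ → Bool) N d → (∀ n → d ℕ.≤ n → T (p n)) → leastTail p N ℕ.≤ d
leastTail-min p zero    d h = z≤n
leastTail-min p (suc N) d h with p N in eq
... | true  = leastTail-min p N d h
... | false with d ℕ.≤? N
...   | yes d≤N = contradiction (subst T eq (h N d≤N)) (λ ())
...   | no  d≰N = ℕ.≰⇒> d≰N

conductor-correct : ∀ Λ → IsConductor Λ (conductor Λ)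
conductor-correct Λ =
  (λ n → leastTail-true (member Λ) N (proj₂ (cofinite Λ)) _ (ℕ.m≤m+n _ n)) ,
  (λ d h → leastTail-min (member Λ) N d
     (λ n d≤n → subst (_∈ₛ Λ) (ℕ.m+[n∸m]≡n d≤n) (h (n ℕ.∸ d))))
  where N = proj₁ (cofinite Λ)

-- A vector v of length N stands for the set {n < N | v n} ∪ [N, ∞).
extend : ∀ {N} → Vec Bool N → ℕ → Bool
extend []      n       = true
extend (b ∷ v) zero    = b
extend (b ∷ v) (suc n) = extend v n

IsSemigroup : (ℕ → Bool) → Set
IsSemigroup p = T (p 0) × (∀ m n → T (p m) → T (p n) → T (p (m ℕ.+ n)))

extend-large : ∀ {N} (v : Vec Bool N) n → N ℕ.≤ n → T (extend v n)
extend-large []      n       _         = tt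
extend-large (b ∷ v) (suc n) (s≤s N≤n) = extend-large v n N≤n

isSemigroup? : ∀ {N} (v : Vec Bool N) → Dec (IsSemigroup (extend v))
isSemigroup? {N} v = T? (p 0) ×-dec map′ to from
  (ℕ.allUpTo? (λ m → ℕ.allUpTo? (λ n → T? (p m) →-dec (T? (p n) →-dec T? (p (m ℕ.+ n)))) N) N)
  where
  p = extend v
  to : (∀ {m} → m ℕ.< N → ∀ {n} → n ℕ.< N → T (p m) → T (p n) → T (p (m ℕ.+ n))) →
       ∀ m n → T (p m) → T (p n) → T (p (m ℕ.+ n))
  to h m n with m ℕ.<? N | n ℕ.<? N
  ... | yes m<N | yes n<N = h m<N n<N
  ... | no  m≮N | _       = λ _ _ → extend-large v _ (ℕ.≤-trans (ℕ.≮⇒≥ m≮N) (ℕ.m≤m+n m n))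
  ... | _       | no  n≮N = λ _ _ → extend-large v _ (ℕ.≤-trans (ℕ.≮⇒≥ n≮N) (ℕ.m≤n+m n m))
  from : (∀ m n → T (p m) → T (p n) → T (p (m ℕ.+ n))) →
         ∀ {m} → m ℕ.< N → ∀ {n} → n ℕ.< N → T (p m) → T (p n) → T (p (m ℕ.+ n))
  from h _ _ = h _ _

toSemigroup : ∀ {N} → Vec Bool N → Maybe NumericalSemigroup
toSemigroup {N} v with isSemigroup? v
... | yes (0∈v , +-cl) = just record
  { member = extend v ; 0∈ = 0∈v ; +-closed = +-cl ; cofinite = N , extend-large v }
... | no _ = nothing

allVecs : ∀ N → List (Vec Bool N)
allVecs zero    = [] ∷ []
allVecs (suc N) = map (true ∷_) (allVecs N) ++ map (false ∷_) (allVecs N)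

-- All numerical semigroups containing [N, ∞).
semigroups : ℕ → List NumericalSemigroup
semigroups N = mapMaybe toSemigroup (allVecs N)

withFrobenius : ℕ → List NumericalSemigroup
withFrobenius f = filter (λ Λ → frobenius Λ ℤ.≟ + f) (semigroups (suc f))

Fr : ℕ → ℕ
Fr f = length (withFrobenius f)

S : ℕ → ℕ
S j = length (filter (λ Λ → multiplicity Λ ℕ.≟ j ℕ.+ 1) (withFrobenius (3 ℕ.* j ℕ.+ 2)))

-- The probability of P under the uniform distribution on the entries of a
-- list.  The value for the empty list is a convention.
uniformℙ : ∀ {A : Set} {P : Pred A 0ℓ} → List A → Decidable P → ℚ
uniformℙ []           P? = 0ℚ
uniformℙ xs@(_ ∷ xs′) P? = + length (filter P? xs) ℚ./ suc (length xs′)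

-- The next lemmas show that withFrobenius f lists the numerical semigroups
-- with Frobenius number f, each exactly once up to _≐_.

withFrobenius-sound : ∀ f {Λ} → Λ ∈ withFrobenius f → frobenius Λ ≡ + f
withFrobenius-sound f Λ∈ = proj₂ (∈-filter⁻ (λ Λ → frobenius Λ ℤ.≟ + f) {xs = semigroups (suc f)} Λ∈)

∈-allVecs : ∀ {N} (v : Vec Bool N) → v ∈ allVecs N
∈-allVecs []          = here refl
∈-allVecs (true  ∷ v) = ∈-++⁺ˡ (∈-map⁺ (true ∷_) (∈-allVecs v))
∈-allVecs (false ∷ v) = ∈-++⁺ʳ (map (true ∷_) (allVecs _)) (∈-map⁺ (false ∷_) (∈-allVecs v))

∷-injectiveʳ : ∀ {N} {b : Bool} {v w : Vec Bool N} → b ∷ v ≡ b ∷ w → v ≡ w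
∷-injectiveʳ refl = refl

allVecs-unique : ∀ N → Unique (allVecs N)
allVecs-unique zero    = [] ∷ []
allVecs-unique (suc N) = Unique.++⁺
  (Unique.map⁺ ∷-injectiveʳ (allVecs-unique N)) (Unique.map⁺ ∷-injectiveʳ (allVecs-unique N))
  λ (l , r) → disjoint (∈-map⁻ (true ∷_) l) (∈-map⁻ (false ∷_) r)
  where
  disjoint : ∀ {u : Vec Bool (suc N)} → (∃ λ v → v ∈ allVecs N × u ≡ true ∷ v) →
             ¬ (∃ λ v → v ∈ allVecs N × u ≡ false ∷ v)
  disjoint (_ , _ , refl) (_ , _ , ())

extend-injective : ∀ {N} (v w : Vec Bool N) → (∀ n → extend v n ≡ extend w n) → v ≡ w
extend-injective []      []      h = refl
extend-injective (b ∷ v) (c ∷ w) h = cong₂ _∷_ (h 0) (extend-injective v w (h ∘ suc))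

toSemigroup-member : ∀ {N} (v : Vec Bool N) {Λ} → toSemigroup v ≡ just Λ → member Λ ≡ extend v
toSemigroup-member v eq with isSemigroup? v
toSemigroup-member v refl | yes _ = refl

mapMaybe-allPairs : ∀ {A B : Set} {R : A → A → Set} {Q : B → B → Set} (g : A → Maybe B) →
  (∀ {x y a b} → R x y → g x ≡ just a → g y ≡ just b → Q a b) →
  ∀ {xs} → AllPairs R xs → AllPairs Q (mapMaybe g xs)
mapMaybe-allPairs g h [] = []
mapMaybe-allPairs {R = R} {Q} g h {x ∷ xs} (px ∷ pxs) with g x in eq
... | nothing = mapMaybe-allPairs g h pxs
... | just a  = go px ∷ mapMaybe-allPairs g h pxs
  where
  go : ∀ {ys} → All (R x) ys → All (Q a) (mapMaybe g ys)
  go [] = []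
  go {y ∷ ys} (r ∷ rs) with g y in eq′
  ... | nothing = go rs
  ... | just b  = h r eq eq′ ∷ go rs

withFrobenius-unique : ∀ f → AllPairs (λ Λ Λ′ → ¬ Λ ≐ Λ′) (withFrobenius f)
withFrobenius-unique f = AllPairs.filter⁺ _
  (mapMaybe-allPairs toSemigroup distinct (allVecs-unique (suc f)))
  where
  distinct : ∀ {v w : Vec Bool (suc f)} {Λ Λ′} → v ≢ w →
             toSemigroup v ≡ just Λ → toSemigroup w ≡ just Λ′ → ¬ Λ ≐ Λ′
  distinct {v} {w} v≢w eq eq′ Λ≐Λ′ = v≢w (extend-injective v w λ n →
    trans (cong (λ p → p n) (sym (toSemigroup-member v eq)))
      (trans (Λ≐Λ′ n) (cong (λ p → p n) (toSemigroup-member w eq′))))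

restrict : ∀ N → (ℕ → Bool) → Vec Bool N
restrict N p = tabulate (p ∘ toℕ)

T⇒≡true : ∀ {b} → T b → b ≡ true
T⇒≡true {true} _ = refl

extend-restrict : ∀ N (p : ℕ → Bool) → (∀ n → N ℕ.≤ n → T (p n)) → ∀ n → extend (restrict N p) n ≡ p n
extend-restrict zero    p h n       = sym (T⇒≡true (h n z≤n))
extend-restrict (suc N) p h zero    = refl
extend-restrict (suc N) p h (suc n) = extend-restrict N (p ∘ suc) (λ n → h (suc n) ∘ s≤s) n

toSemigroup-complete : ∀ {N} (v : Vec Bool N) Λ → (∀ n → extend v n ≡ member Λ n) →
                       ∃ λ Λ′ → toSemigroup v ≡ just Λ′ × Λ′ ≐ Λ
toSemigroup-complete v Λ h with isSemigroup? v
... | yes _ = _ , refl , h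
... | no ¬s = contradiction
  ( subst T (sym (h 0)) (0∈ Λ)
  , λ m n m∈ n∈ → subst T (sym (h _)) (+-closed Λ m n (subst T (h m) m∈) (subst T (h n) n∈))) ¬s

∈-mapMaybe : ∀ {A B : Set} (g : A → Maybe B) {x a xs} → x ∈ xs → g x ≡ just a → a ∈ mapMaybe g xs
∈-mapMaybe g {xs = x ∷ xs} (here refl) eq rewrite eq = here refl
∈-mapMaybe g {xs = y ∷ xs} (there x∈)  eq with g y
... | just _  = there (∈-mapMaybe g x∈ eq)
... | nothing = ∈-mapMaybe g x∈ eq

conductor-cong : ∀ {Λ Λ′} → Λ ≐ Λ′ → conductor Λ ≡ conductor Λ′
conductor-cong {Λ} {Λ′} h = ℕ.≤-antisym
  (proj₂ (conductor-correct Λ)  _ λ n → subst T (sym (h _)) (proj₁ (conductor-correct Λ′) n))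
  (proj₂ (conductor-correct Λ′) _ λ n → subst T (h _) (proj₁ (conductor-correct Λ) n))

withFrobenius-complete : ∀ f Λ → frobenius Λ ≡ + f → ∃ λ Λ′ → Λ′ ∈ withFrobenius f × Λ′ ≐ Λ
withFrobenius-complete f Λ eq =
  let v = restrict (suc f) (member Λ)
      (Λ′ , eq′ , Λ′≐Λ) = toSemigroup-complete v Λ (extend-restrict (suc f) (member Λ) tail)
  in Λ′ , ∈-filter⁺ (λ Λ → frobenius Λ ℤ.≟ + f) (∈-mapMaybe toSemigroup (∈-allVecs v) eq′)
            (trans (cong (λ c → + c ℤ.- + 1) (conductor-cong {Λ′} {Λ} Λ′≐Λ)) eq) , Λ′≐Λ
  where
  pred : ∀ c → + c ℤ.- + 1 ≡ + f → c ≡ suc f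
  pred (suc c) refl = refl
  tail : ∀ n → suc f ℕ.≤ n → n ∈ₛ Λ
  tail n f<n = leastTail-true (member Λ) _ (proj₂ (cofinite Λ)) n
    (subst (ℕ._≤ n) (sym (pred (conductor Λ) eq)) f<n)

-- Thus the empty list is never met for f ≥ 1: {0} ∪ [f + 1, ∞) is listed.
Fr>0 : ∀ f → 0 ℕ.< Fr (suc f)
Fr>0 f = nonempty (proj₁ (proj₂ (withFrobenius-complete (suc f) Λ (cong (λ c → + c ℤ.- + 1) c≡))))
  where
  nonempty : ∀ {A : Set} {x : A} {xs} → x ∈ xs → 0 ℕ.< length xs
  nonempty (here _)  = s≤s z≤n
  nonempty (there _) = s≤s z≤n
  p : ℕ → Bool
  p zero    = true
  p (suc n) = suc f ℕ.≤ᵇ n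
  closed : ∀ m n → T (p m) → T (p n) → T (p (m ℕ.+ n))
  closed zero    n _  pn = pn
  closed (suc m) n pm _  = ℕ.≤⇒≤ᵇ (ℕ.≤-trans (ℕ.≤ᵇ⇒≤ (suc f) m pm) (ℕ.m≤m+n m n))
  large : ∀ n → suc (suc f) ℕ.≤ n → T (p n)
  large (suc n) (s≤s le) = ℕ.≤⇒≤ᵇ le
  Λ : NumericalSemigroup
  Λ = record { member = p ; 0∈ = tt ; +-closed = closed ; cofinite = suc (suc f) , large }
  c≡ : conductor Λ ≡ suc (suc f)
  c≡ with p (suc f) in eq
  ... | false = refl
  ... | true  = contradiction (ℕ.≤ᵇ⇒≤ (suc f) f (subst T (sym eq) tt)) (ℕ.<-irrefl refl)

-- Reals are Cauchy sequences of rationals, with equality _≈ℝ_.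
IsCauchy : (ℕ → ℚ) → Set
IsCauchy x = ∀ ε → 0ℚ ℚ.< ε → ∃ λ N → ∀ m n → N ℕ.≤ m → N ℕ.≤ n → ℚ.∣ x m ℚ.- x n ∣ ℚ.< ε

record ℝ : Set where
  constructor mkℝ
  field
    seq    : ℕ → ℚ
    cauchy : IsCauchy seq

open ℝ public

infix 4 _≈ℝ_ _<ℝ_

_≈ℝ_ : ℝ → ℝ → Set
x ≈ℝ y = ∀ ε → 0ℚ ℚ.< ε → ∃ λ N → ∀ n → N ℕ.≤ n → ℚ.∣ seq x n ℚ.- seq y n ∣ ℚ.< ε

_<ℝ_ : ℝ → ℝ → Set
x <ℝ y = ∃ λ δ → 0ℚ ℚ.< δ × ∃ λ N → ∀ n → N ℕ.≤ n → seq x n ℚ.+ δ ℚ.≤ seq y n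

∣p-p∣<ε : ∀ p {ε} → 0ℚ ℚ.< ε → ℚ.∣ p ℚ.- p ∣ ℚ.< ε
∣p-p∣<ε p 0<ε = subst (λ q → ℚ.∣ q ∣ ℚ.< _) (sym (ℚ.+-inverseʳ p)) 0<ε

fromℚ : ℚ → ℝ
fromℚ q = mkℝ (λ _ → q) λ ε 0<ε → 0 , λ _ _ _ _ → ∣p-p∣<ε q 0<ε

fromℕ : ℕ → ℝ
fromℕ n = fromℚ (+ n ℚ./ 1)

0ℝ 1ℝ 2ℝ : ℝ
0ℝ = fromℕ 0
1ℝ = fromℕ 1
2ℝ = fromℕ 2

0<½* : ∀ {ε} → 0ℚ ℚ.< ε → 0ℚ ℚ.< ½ ℚ.* ε
0<½* {ε} 0<ε = ℚ.positive⁻¹ _ {{ℚ.pos*pos⇒pos ½ ε {{ℚ.positive 0<ε}}}}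

½*+½* : ∀ ε → ½ ℚ.* ε ℚ.+ ½ ℚ.* ε ≡ ε
½*+½* ε = trans (sym (ℚ.*-distribʳ-+ ε ½ ½)) (ℚ.*-identityˡ ε)

+-halves : ∀ {p q ε} → p ℚ.< ½ ℚ.* ε → q ℚ.< ½ ℚ.* ε → p ℚ.+ q ℚ.< ε
+-halves {ε = ε} p< q< = subst (_ ℚ.<_) (½*+½* ε) (ℚ.+-mono-< p< q<)

≤⊔ˡ : ∀ {N M n} → N ℕ.⊔ M ℕ.≤ n → N ℕ.≤ n
≤⊔ˡ = ℕ.≤-trans (ℕ.m≤m⊔n _ _)

≤⊔ʳ : ∀ {N M n} → N ℕ.⊔ M ℕ.≤ n → M ℕ.≤ n
≤⊔ʳ = ℕ.≤-trans (ℕ.m≤n⊔m _ _)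

infixl 6 _-ℝ_
infixl 7 _*ℝ_
infix  8 ∣_∣ℝ

_-ℝ_ : ℝ → ℝ → ℝ
x -ℝ y = mkℝ (λ n → seq x n ℚ.- seq y n) λ ε 0<ε →
  let (N , hx) = cauchy x (½ ℚ.* ε) (0<½* 0<ε)
      (M , hy) = cauchy y (½ ℚ.* ε) (0<½* 0<ε)
  in N ℕ.⊔ M , λ m n m≥ n≥ → ℚ.≤-<-trans (bound (seq x m) (seq y m) (seq x n) (seq y n))
       (+-halves (hx m n (≤⊔ˡ m≥) (≤⊔ˡ n≥)) (hy m n (≤⊔ʳ m≥) (≤⊔ʳ n≥)))
  where
  open +-*-Solver
  bound : ∀ a b c d → ℚ.∣ (a ℚ.- b) ℚ.- (c ℚ.- d) ∣ ℚ.≤ ℚ.∣ a ℚ.- c ∣ ℚ.+ ℚ.∣ b ℚ.- d ∣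
  bound a b c d = subst (λ q → ℚ.∣ q ∣ ℚ.≤ ℚ.∣ a ℚ.- c ∣ ℚ.+ ℚ.∣ b ℚ.- d ∣)
    (solve 4 (λ a b c d → (a :- c) :- (b :- d) := (a :- b) :- (c :- d)) refl a b c d)
    (ℚ.∣p-q∣≤∣p∣+∣q∣ (a ℚ.- c) (b ℚ.- d))

∣p∣≤∣p-q∣+∣q∣ : ∀ p q → ℚ.∣ p ∣ ℚ.≤ ℚ.∣ p ℚ.- q ∣ ℚ.+ ℚ.∣ q ∣
∣p∣≤∣p-q∣+∣q∣ p q = subst (λ r → ℚ.∣ r ∣ ℚ.≤ ℚ.∣ p ℚ.- q ∣ ℚ.+ ℚ.∣ q ∣)
  (solve 2 (λ p q → (p :- q) :+ q := p) refl p q) (ℚ.∣p+q∣≤∣p∣+∣q∣ (p ℚ.- q) q)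
  where open +-*-Solver

∣p-q∣≡∣q-p∣ : ∀ p q → ℚ.∣ p ℚ.- q ∣ ≡ ℚ.∣ q ℚ.- p ∣
∣p-q∣≡∣q-p∣ p q = trans (sym (ℚ.∣-p∣≡∣p∣ (p ℚ.- q)))
  (cong ℚ.∣_∣ (solve 2 (λ p q → :- (p :- q) := q :- p) refl p q))
  where open +-*-Solver

p≤q+r⇒p-r≤q : ∀ {p q r} → p ℚ.≤ q ℚ.+ r → p ℚ.- r ℚ.≤ q
p≤q+r⇒p-r≤q {p} {q} {r} h = subst (p ℚ.- r ℚ.≤_)
  (solve 2 (λ q r → (q :+ r) :- r := q) refl q r) (ℚ.+-monoˡ-≤ (ℚ.- r) h)
  where open +-*-Solver

∣∣p∣-∣q∣∣≤∣p-q∣ : ∀ p q → ℚ.∣ ℚ.∣ p ∣ ℚ.- ℚ.∣ q ∣ ∣ ℚ.≤ ℚ.∣ p ℚ.- q ∣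
∣∣p∣-∣q∣∣≤∣p-q∣ p q with ℚ.∣p∣≡p∨∣p∣≡-p (ℚ.∣ p ∣ ℚ.- ℚ.∣ q ∣)
... | inj₁ eq = subst (ℚ._≤ ℚ.∣ p ℚ.- q ∣) (sym eq) (p≤q+r⇒p-r≤q (∣p∣≤∣p-q∣+∣q∣ p q))
... | inj₂ eq = subst₂ ℚ._≤_
  (sym (trans eq (solve 2 (λ p q → :- (p :- q) := q :- p) refl ℚ.∣ p ∣ ℚ.∣ q ∣)))
  (∣p-q∣≡∣q-p∣ q p) (p≤q+r⇒p-r≤q (∣p∣≤∣p-q∣+∣q∣ q p))
  where open +-*-Solver

∣_∣ℝ : ℝ → ℝ
∣ x ∣ℝ = mkℝ (λ n → ℚ.∣ seq x n ∣) λ ε 0<ε →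
  let (N , h) = cauchy x ε 0<ε
  in N , λ m n m≥ n≥ → ℚ.≤-<-trans (∣∣p∣-∣q∣∣≤∣p-q∣ (seq x m) (seq x n)) (h m n m≥ n≥)

seq-bounded : ∀ x → ∃ λ B → 0ℚ ℚ.< B × ∃ λ N → ∀ n → N ℕ.≤ n → ℚ.∣ seq x n ∣ ℚ.≤ B
seq-bounded x =
  let (N , h) = cauchy x 1ℚ (ℚ.positive⁻¹ 1ℚ)
      B = 1ℚ ℚ.+ ℚ.∣ seq x N ∣
  in B , ℚ.<-≤-trans (ℚ.positive⁻¹ 1ℚ)
           (subst (ℚ._≤ B) (ℚ.+-identityʳ 1ℚ) (ℚ.+-monoʳ-≤ 1ℚ (ℚ.0≤∣p∣ (seq x N)))) ,
     N , λ n n≥ → ℚ.≤-trans (∣p∣≤∣p-q∣+∣q∣ (seq x n) (seq x N))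
           (ℚ.+-monoˡ-≤ _ (ℚ.<⇒≤ (h n N n≥ ℕ.≤-refl)))

-- The reciprocal, with the convention that it is 0 at 0.
recip : ℚ → ℚ
recip q with q ℚ.≟ 0ℚ
... | yes _  = 0ℚ
... | no q≢0 = (ℚ.1/ q) {{ℚ.≢-nonZero q≢0}}

*-recip : ∀ {q} → 0ℚ ℚ.< q → q ℚ.* recip q ≡ 1ℚ
*-recip {q} 0<q with q ℚ.≟ 0ℚ
... | yes q≡0 = contradiction (sym q≡0) (ℚ.<⇒≢ 0<q)
... | no q≢0  = ℚ.*-inverseʳ q {{ℚ.≢-nonZero q≢0}}

recip-pos : ∀ {q} → 0ℚ ℚ.< q → 0ℚ ℚ.< recip q
recip-pos {q} 0<q with q ℚ.≟ 0ℚ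
... | yes q≡0 = contradiction (sym q≡0) (ℚ.<⇒≢ 0<q)
... | no q≢0  = ℚ.positive⁻¹ _ {{ℚ.1/pos⇒pos q {{ℚ.positive 0<q}}}}

*-mono-≤-< : ∀ {a b B δ} → 0ℚ ℚ.≤ b → 0ℚ ℚ.< B → a ℚ.≤ B → b ℚ.< δ → a ℚ.* b ℚ.< B ℚ.* δ
*-mono-≤-< {a} {b} {B} {δ} 0≤b 0<B a≤B b<δ = ℚ.≤-<-trans
  (ℚ.*-monoʳ-≤-nonNeg b {{ℚ.nonNegative 0≤b}} a≤B)
  (ℚ.*-monoʳ-<-pos B {{ℚ.positive 0<B}} b<δ)

*-pos : ∀ {p q} → 0ℚ ℚ.< p → 0ℚ ℚ.< q → 0ℚ ℚ.< p ℚ.* q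
*-pos {p} {q} 0<p 0<q = ℚ.positive⁻¹ _ {{ℚ.pos*pos⇒pos p {{ℚ.positive 0<p}} q {{ℚ.positive 0<q}}}}

*-recip-cancel : ∀ {B} ε → 0ℚ ℚ.< B → B ℚ.* (recip B ℚ.* ε) ≡ ε
*-recip-cancel {B} ε 0<B = trans (sym (ℚ.*-assoc B (recip B) ε))
  (trans (cong (ℚ._* ε) (*-recip 0<B)) (ℚ.*-identityˡ ε))

_*ℝ_ : ℝ → ℝ → ℝ
x *ℝ y = mkℝ (λ n → seq x n ℚ.* seq y n) λ ε 0<ε →
  let (A , 0<A , Nx , bx) = seq-bounded x
      (B , 0<B , Ny , by) = seq-bounded y
      0<½ε = 0<½* 0<ε
      (Mx , hx) = cauchy x (recip B ℚ.* (½ ℚ.* ε)) (*-pos (recip-pos 0<B) 0<½ε)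
      (My , hy) = cauchy y (recip A ℚ.* (½ ℚ.* ε)) (*-pos (recip-pos 0<A) 0<½ε)
  in (Nx ℕ.⊔ Ny) ℕ.⊔ (Mx ℕ.⊔ My) , λ m n m≥ n≥ →
     ℚ.≤-<-trans (bound (seq x m) (seq y m) (seq x n) (seq y n)) (+-halves
       (subst (_ ℚ.<_) (*-recip-cancel _ 0<A)
         (*-mono-≤-< (ℚ.0≤∣p∣ (seq y m ℚ.- seq y n)) 0<A (bx m (≤⊔ˡ (≤⊔ˡ m≥)))
           (hy m n (≤⊔ʳ {Mx} (≤⊔ʳ {Nx ℕ.⊔ Ny} m≥)) (≤⊔ʳ {Mx} (≤⊔ʳ {Nx ℕ.⊔ Ny} n≥)))))
       (subst (_ ℚ.<_) (*-recip-cancel _ 0<B)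
         (*-mono-≤-< (ℚ.0≤∣p∣ (seq x m ℚ.- seq x n)) 0<B (by n (≤⊔ʳ {Nx} (≤⊔ˡ n≥)))
           (hx m n (≤⊔ˡ (≤⊔ʳ {Nx ℕ.⊔ Ny} m≥)) (≤⊔ˡ (≤⊔ʳ {Nx ℕ.⊔ Ny} n≥))))))
  where
  open +-*-Solver
  bound : ∀ a b c d → ℚ.∣ a ℚ.* b ℚ.- c ℚ.* d ∣ ℚ.≤
                      ℚ.∣ a ∣ ℚ.* ℚ.∣ b ℚ.- d ∣ ℚ.+ ℚ.∣ d ∣ ℚ.* ℚ.∣ a ℚ.- c ∣
  bound a b c d = subst₂ ℚ._≤_
    (cong ℚ.∣_∣ (solve 4 (λ a b c d → a :* (b :- d) :+ d :* (a :- c) := a :* b :- c :* d) refl a b c d))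
    (cong₂ ℚ._+_ (ℚ.∣p*q∣≡∣p∣*∣q∣ a (b ℚ.- d)) (ℚ.∣p*q∣≡∣p∣*∣q∣ d (a ℚ.- c)))
    (ℚ.∣p+q∣≤∣p∣+∣q∣ (a ℚ.* (b ℚ.- d)) (d ℚ.* (a ℚ.- c)))

recip-diff : ∀ {p q} → 0ℚ ℚ.< p → 0ℚ ℚ.< q →
             recip p ℚ.- recip q ≡ (recip p ℚ.* recip q) ℚ.* (q ℚ.- p)
recip-diff {p} {q} 0<p 0<q = begin
  recip p ℚ.- recip q
    ≡⟨ cong₂ ℚ._-_ (sym (ℚ.*-identityʳ (recip p))) (sym (ℚ.*-identityʳ (recip q))) ⟩
  recip p ℚ.* 1ℚ ℚ.- recip q ℚ.* 1ℚ
    ≡⟨ cong₂ (λ a b → recip p ℚ.* a ℚ.- recip q ℚ.* b) (sym (*-recip 0<q)) (sym (*-recip 0<p)) ⟩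
  recip p ℚ.* (q ℚ.* recip q) ℚ.- recip q ℚ.* (p ℚ.* recip p)
    ≡⟨ solve 4 (λ p q a b → a :* (q :* b) :- b :* (p :* a) := (a :* b) :* (q :- p))
         refl p q (recip p) (recip q) ⟩
  (recip p ℚ.* recip q) ℚ.* (q ℚ.- p) ∎
  where
  open +-*-Solver
  open ≡-Reasoning

recip-antimono : ∀ {p q} → 0ℚ ℚ.< p → p ℚ.≤ q → recip q ℚ.≤ recip p
recip-antimono {p} {q} 0<p p≤q = subst₂ ℚ._≤_
  (trans (cong (p ℚ.*_) (ℚ.*-comm (recip q) (recip p))) (*-recip-cancel (recip q) 0<p))
  (*-recip-cancel (recip p) 0<q)
  (ℚ.*-monoʳ-≤-nonNeg (recip q ℚ.* recip p)
    {{ℚ.nonNegative (ℚ.<⇒≤ (*-pos (recip-pos 0<q) (recip-pos 0<p)))}} p≤q)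
  where 0<q = ℚ.<-≤-trans 0<p p≤q

*-mono-≤-nonNeg : ∀ {a b c d} → 0ℚ ℚ.≤ b → 0ℚ ℚ.≤ c → a ℚ.≤ c → b ℚ.≤ d → a ℚ.* b ℚ.≤ c ℚ.* d
*-mono-≤-nonNeg {b = b} {c} 0≤b 0≤c a≤c b≤d = ℚ.≤-trans
  (ℚ.*-monoʳ-≤-nonNeg b {{ℚ.nonNegative 0≤b}} a≤c) (ℚ.*-monoˡ-≤-nonNeg c {{ℚ.nonNegative 0≤c}} b≤d)

∣recip-diff∣≤ : ∀ {p q δ} → 0ℚ ℚ.< δ → δ ℚ.≤ p → δ ℚ.≤ q →
  ∃ λ a → ℚ.∣ recip p ℚ.- recip q ∣ ≡ a ℚ.* ℚ.∣ p ℚ.- q ∣ × a ℚ.≤ recip δ ℚ.* recip δ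
∣recip-diff∣≤ {p} {q} {δ} 0<δ δ≤p δ≤q = recip p ℚ.* recip q ,
  (begin
    ℚ.∣ recip p ℚ.- recip q ∣                        ≡⟨ cong ℚ.∣_∣ (recip-diff 0<p 0<q) ⟩
    ℚ.∣ (recip p ℚ.* recip q) ℚ.* (q ℚ.- p) ∣        ≡⟨ ℚ.∣p*q∣≡∣p∣*∣q∣ (recip p ℚ.* recip q) (q ℚ.- p) ⟩
    ℚ.∣ recip p ℚ.* recip q ∣ ℚ.* ℚ.∣ q ℚ.- p ∣      ≡⟨ cong₂ ℚ._*_ (ℚ.0≤p⇒∣p∣≡p (ℚ.<⇒≤ (*-pos (recip-pos 0<p) (recip-pos 0<q)))) (∣p-q∣≡∣q-p∣ q p) ⟩
    recip p ℚ.* recip q ℚ.* ℚ.∣ p ℚ.- q ∣            ∎) ,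
  *-mono-≤-nonNeg (ℚ.<⇒≤ (recip-pos 0<q)) (ℚ.<⇒≤ (recip-pos 0<δ))
    (recip-antimono 0<δ δ≤p) (recip-antimono 0<δ δ≤q)
  where
  open ≡-Reasoning
  0<p = ℚ.<-≤-trans 0<δ δ≤p
  0<q = ℚ.<-≤-trans 0<δ δ≤q

invℝ : (x : ℝ) → 0ℝ <ℝ x → ℝ
invℝ x (δ , 0<δ , N , h) = mkℝ (λ n → recip (seq x n)) λ ε 0<ε →
  let B   = recip δ ℚ.* recip δ
      0<B = *-pos (recip-pos 0<δ) (recip-pos 0<δ)
      (M , hx) = cauchy x (recip B ℚ.* ε) (*-pos (recip-pos 0<B) 0<ε)
  in N ℕ.⊔ M , λ m n m≥ n≥ →
     let (a , eq , a≤B) = ∣recip-diff∣≤ 0<δ (δ≤ m (≤⊔ˡ m≥)) (δ≤ n (≤⊔ˡ n≥))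
     in subst₂ ℚ._<_ (sym eq) (*-recip-cancel ε 0<B)
          (*-mono-≤-< (ℚ.0≤∣p∣ (seq x m ℚ.- seq x n)) 0<B a≤B (hx m n (≤⊔ʳ m≥) (≤⊔ʳ n≥)))
  where
  δ≤ : ∀ n → N ℕ.≤ n → δ ℚ.≤ seq x n
  δ≤ n n≥ = subst (ℚ._≤ seq x n) (ℚ.+-identityˡ δ) (h n n≥)

*-invℝ : ∀ x (x>0 : 0ℝ <ℝ x) → x *ℝ invℝ x x>0 ≈ℝ 1ℝ
*-invℝ x (δ , 0<δ , N , h) ε 0<ε = N , λ n n≥ →
  subst (λ q → ℚ.∣ q ℚ.- 1ℚ ∣ ℚ.< ε)
    (sym (*-recip (ℚ.<-≤-trans 0<δ (subst (ℚ._≤ seq x n) (ℚ.+-identityˡ δ) (h n n≥)))))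
    (∣p-p∣<ε 1ℚ 0<ε)

-- √2 is the limit of the continued fraction 1 + 1/(2 + 1/(2 + ⋯)).
√2-seq : ℕ → ℚ
√2-seq zero    = 1ℚ
√2-seq (suc n) = 1ℚ ℚ.+ recip (1ℚ ℚ.+ √2-seq n)

½^ : ℕ → ℚ
½^ zero    = 1ℚ
½^ (suc n) = ½ ℚ.* ½^ n

2ℚ : ℚ
2ℚ = 1ℚ ℚ.+ 1ℚ

0<1 : 0ℚ ℚ.< 1ℚ
0<1 = ℚ.positive⁻¹ 1ℚ

0<2 : 0ℚ ℚ.< 2ℚ
0<2 = ℚ.positive⁻¹ 2ℚ

½^-pos : ∀ n → 0ℚ ℚ.< ½^ n
½^-pos zero    = 0<1
½^-pos (suc n) = 0<½* (½^-pos n)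

fromℕℚ : ℕ → ℚ
fromℕℚ zero    = 0ℚ
fromℕℚ (suc n) = 1ℚ ℚ.+ fromℕℚ n

0≤fromℕℚ : ∀ n → 0ℚ ℚ.≤ fromℕℚ n
0≤fromℕℚ zero    = ℚ.≤-refl
0≤fromℕℚ (suc n) = ℚ.+-mono-≤ (ℚ.<⇒≤ 0<1) (0≤fromℕℚ n)

fromℕℚ-toℚᵘ : ∀ n → ℚᵘ.mkℚᵘ (+ n) 0 ℚᵘ.≃ ℚ.toℚᵘ (fromℕℚ n)
fromℕℚ-toℚᵘ zero    = ℚᵘ.*≡* refl
fromℕℚ-toℚᵘ (suc n) = ℚᵘ.≃-trans {j = ℚᵘ.1ℚᵘ ℚᵘ.+ ℚᵘ.mkℚᵘ (+ n) 0}
  (ℚᵘ.*≡* (cong (λ z → (+ 1 ℤ.+ z) ℤ.* + 1) (sym (ℤ.*-identityʳ (+ n)))))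
  (ℚᵘ.≃-trans (ℚᵘ.+-congʳ ℚᵘ.1ℚᵘ (fromℕℚ-toℚᵘ n)) (ℚᵘ.≃-sym (ℚ.toℚᵘ-homo-+ 1ℚ (fromℕℚ n))))

archimedean : ∀ q → ∃ λ n → q ℚ.≤ fromℕℚ n
archimedean q@(mkℚ a d _) = ℤ.∣ a ∣ , ℚ.toℚᵘ-cancel-≤
  (ℚᵘ.≤-respʳ-≃ (fromℕℚ-toℚᵘ ℤ.∣ a ∣) (ℚᵘ.*≤* (step a)))
  where
  step : ∀ a → a ℤ.* + 1 ℤ.≤ + ℤ.∣ a ∣ ℤ.* + suc d
  step (+ n) = subst₂ ℤ._≤_ (sym (ℤ.*-identityʳ (+ n))) (ℤ.pos-* n (suc d)) (ℤ.+≤+ (ℕ.m≤m*n n (suc d)))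
  step (-[1+ n ]) = subst (-[1+ n ] ℤ.* + 1 ℤ.≤_) (ℤ.pos-* (suc n) (suc d)) ℤ.-≤+

½^-bound : ∀ n → ½^ n ℚ.* fromℕℚ (suc n) ℚ.≤ 1ℚ
½^-bound zero    = ℚ.≤-refl
½^-bound (suc n) = ℚ.≤-trans (subst₂ ℚ._≤_ refl
  (solve 2 (λ h i → (con ½ :* h) :* ((con 1ℚ :+ i) :+ (con 1ℚ :+ i)) := h :* (con 1ℚ :+ i)) refl (½^ n) (fromℕℚ n))
  (ℚ.*-monoˡ-≤-nonNeg (½^ (suc n)) {{ℚ.nonNegative (ℚ.<⇒≤ (½^-pos (suc n)))}}
    (ℚ.+-monoˡ-≤ (fromℕℚ (suc n)) (subst (ℚ._≤ fromℕℚ (suc n)) (ℚ.+-identityʳ 1ℚ) (ℚ.+-monoʳ-≤ 1ℚ (0≤fromℕℚ n))))))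
  (½^-bound n)
  where open +-*-Solver

½^-small : ∀ ε → 0ℚ ℚ.< ε → ∃ λ n → ½^ n ℚ.< ε
½^-small ε 0<ε =
  let (n , le) = archimedean (recip ε)
      lt = ℚ.≤-<-trans le (subst (ℚ._< fromℕℚ (suc n)) (ℚ.+-identityˡ _) (ℚ.+-monoˡ-< (fromℕℚ n) 0<1))
  in n , ℚ.*-cancelʳ-<-nonNeg (fromℕℚ (suc n)) {{ℚ.nonNegative (0≤fromℕℚ (suc n))}}
       (ℚ.≤-<-trans (½^-bound n)
         (subst (ℚ._< ε ℚ.* fromℕℚ (suc n)) (*-recip 0<ε) (ℚ.*-monoʳ-<-pos ε {{ℚ.positive 0<ε}} lt)))

1≤√2-seq : ∀ n → 1ℚ ℚ.≤ √2-seq n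
2≤1+√2-seq : ∀ n → 2ℚ ℚ.≤ 1ℚ ℚ.+ √2-seq n
1≤√2-seq zero    = ℚ.≤-refl
1≤√2-seq (suc n) = subst (ℚ._≤ √2-seq (suc n)) (ℚ.+-identityʳ 1ℚ)
  (ℚ.+-monoʳ-≤ 1ℚ (ℚ.<⇒≤ (recip-pos (ℚ.<-≤-trans 0<2 (2≤1+√2-seq n)))))
2≤1+√2-seq n = ℚ.+-monoʳ-≤ 1ℚ (1≤√2-seq n)

√2-seq≤2 : ∀ n → √2-seq n ℚ.≤ 2ℚ
√2-seq≤2 zero    = ℚ.<⇒≤ (ℚ.+-monoʳ-< 1ℚ 0<1)
√2-seq≤2 (suc n) = ℚ.+-monoʳ-≤ 1ℚ
  (recip-antimono 0<1 (ℚ.≤-trans (ℚ.<⇒≤ (ℚ.+-monoʳ-< 1ℚ 0<1)) (2≤1+√2-seq n)))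

√2-seq-diff : ∀ N m n → N ℕ.≤ m → N ℕ.≤ n → ℚ.∣ √2-seq m ℚ.- √2-seq n ∣ ℚ.≤ ½^ N
√2-seq-diff zero m n _ _ with ℚ.∣p∣≡p∨∣p∣≡-p (√2-seq m ℚ.- √2-seq n)
... | inj₁ eq = subst (ℚ._≤ 1ℚ) (sym eq)
  (ℚ.+-mono-≤ (√2-seq≤2 m) (ℚ.neg-antimono-≤ (1≤√2-seq n)))
... | inj₂ eq = subst (ℚ._≤ 1ℚ)
  (sym (trans eq (solve 2 (λ p q → :- (p :- q) := q :- p) refl (√2-seq m) (√2-seq n))))
  (ℚ.+-mono-≤ (√2-seq≤2 n) (ℚ.neg-antimono-≤ (1≤√2-seq m)))
  where open +-*-Solver
√2-seq-diff (suc N) (suc m) (suc n) (s≤s N≤m) (s≤s N≤n) =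
  let (a , eq , a≤) = ∣recip-diff∣≤ 0<2 (2≤1+√2-seq m) (2≤1+√2-seq n)
  in subst (ℚ._≤ ½^ (suc N)) (trans (trans (cong (a ℚ.*_) (cong ℚ.∣_∣ (shift (√2-seq m) (√2-seq n)))) (sym eq))
       (cong ℚ.∣_∣ (shift (recip (1ℚ ℚ.+ √2-seq m)) (recip (1ℚ ℚ.+ √2-seq n)))))
     (*-mono-≤-nonNeg {a} (ℚ.0≤∣p∣ (√2-seq m ℚ.- √2-seq n)) (ℚ.<⇒≤ (ℚ.positive⁻¹ ½))
       (ℚ.≤-trans a≤ (ℚ.≤ᵇ⇒≤ tt)) (√2-seq-diff N m n N≤m N≤n))
  where
  open +-*-Solver
  shift : ∀ p q → p ℚ.- q ≡ (1ℚ ℚ.+ p) ℚ.- (1ℚ ℚ.+ q)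
  shift = solve 2 (λ p q → p :- q := (con 1ℚ :+ p) :- (con 1ℚ :+ q)) refl

√2 : ℝ
√2 = mkℝ √2-seq λ ε 0<ε →
  let (N , ½^N<ε) = ½^-small ε 0<ε
  in N , λ m n m≥ n≥ → ℚ.≤-<-trans (√2-seq-diff N m n m≥ n≥) ½^N<ε

√2>0 : 0ℝ <ℝ √2
√2>0 = 1ℚ , 0<1 , 0 , λ n _ → 1≤√2-seq n

√2*√2≈2 : √2 *ℝ √2 ≈ℝ 2ℝ
√2*√2≈2 ε 0<ε =
  let 3ℚ = 1ℚ ℚ.+ 2ℚ
      (N , h) = cauchy √2 (recip 3ℚ ℚ.* ε) (*-pos (ℚ.positive⁻¹ (recip 3ℚ)) 0<ε)
  in N , λ n n≥ → let s = √2-seq n ; s′ = √2-seq (suc n) in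
     subst₂ ℚ._<_ (sym (trans (cong ℚ.∣_∣ (identity n)) (trans (ℚ.∣p*q∣≡∣p∣*∣q∣ (1ℚ ℚ.+ s) (s ℚ.- s′))
         (cong (ℚ._* ℚ.∣ s ℚ.- s′ ∣) (ℚ.0≤p⇒∣p∣≡p (ℚ.≤-trans (ℚ.<⇒≤ 0<2) (2≤1+√2-seq n)))))))
       (*-recip-cancel ε (ℚ.positive⁻¹ 3ℚ))
       (*-mono-≤-< (ℚ.0≤∣p∣ (s ℚ.- s′)) (ℚ.positive⁻¹ 3ℚ) (ℚ.+-monoʳ-≤ 1ℚ (√2-seq≤2 n))
         (h n (suc n) n≥ (ℕ.m≤n⇒m≤1+n n≥)))
  where
  open +-*-Solver
  identity : ∀ n → √2-seq n ℚ.* √2-seq n ℚ.- 2ℚ ≡ (1ℚ ℚ.+ √2-seq n) ℚ.* (√2-seq n ℚ.- √2-seq (suc n))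
  identity n = trans
    (cong (λ q → √2-seq n ℚ.* √2-seq n ℚ.- (1ℚ ℚ.+ q)) (sym (*-recip (ℚ.<-≤-trans 0<2 (2≤1+√2-seq n)))))
    (solve 2 (λ s r → s :* s :- (con 1ℚ :+ (con 1ℚ :+ s) :* r) := (con 1ℚ :+ s) :* (s :- (con 1ℚ :+ r)))
       refl (√2-seq n) (recip (1ℚ ℚ.+ √2-seq n)))

infixr 8 _^ℝ_

_^ℝ_ : ℝ → ℕ → ℝ
x ^ℝ zero  = 1ℝ
x ^ℝ suc n = x *ℝ x ^ℝ n

zpow : (x : ℝ) → 0ℝ <ℝ x → ℤ → ℝ
zpow x x>0 (+ n)    = x ^ℝ n
zpow x x>0 -[1+ n ] = invℝ x x>0 ^ℝ suc n

2>0 : 0ℝ <ℝ 2ℝ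
2>0 = 1ℚ , 0<1 , 0 , λ _ _ → ℚ.≤ᵇ⇒≤ tt

2^_ : ℤ → ℝ
2^ z = zpow 2ℝ 2>0 z

-- 2 to the power z/2, as the z-th power of √2.
2^[_/2] : ℤ → ℝ
2^[ z /2] = zpow √2 √2>0 z

Even Odd : ℕ → Set
Even f = ∃ λ n → f ≡ 2 ℕ.* n
Odd  f = ∃ λ n → f ≡ 2 ℕ.* n ℕ.+ 1

Lim : (P : ℕ → Set) (a : ℕ → ℝ) (L : ℝ) → Set
Lim P a L = ∀ ε → 0ℚ ℚ.< ε → ∃ λ N → ∀ f → N ℕ.≤ f → P f → ∣ a f -ℝ L ∣ℝ <ℝ fromℚ ε

ℙ[f-2m≡_] : ℤ → ℕ → ℝ
ℙ[f-2m≡ z ] f = fromℚ (uniformℙ (withFrobenius f)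
  (λ Λ → + f ℤ.- + 2 ℤ.* + multiplicity Λ ℤ.≟ z))

scaledFr : ℕ → ℝ
scaledFr f = 2^[ ℤ.- + f /2] *ℝ fromℕ (Fr f)

evenLimit : (C₀ : ℝ) → 0ℝ <ℝ C₀ → ℤ → ℝ
evenLimit C₀ C₀>0 k@(-[1+ _ ]) = invℝ C₀ C₀>0 *ℝ 2^ (k ℤ.- + 1)
evenLimit C₀ C₀>0 +0           = 0ℝ
evenLimit C₀ C₀>0 k@(+[1+ n ]) =
  invℝ C₀ C₀>0 *ℝ 2^ (ℤ.- (+ 3 ℤ.* k) ℤ.- + 1) *ℝ fromℕ (S (2 ℕ.* suc n))

oddLimit : (C₁ : ℝ) → 0ℝ <ℝ C₁ → ℤ → ℝ
oddLimit C₁ C₁>0 k@(-[1+ _ ]) = invℝ C₁ C₁>0 *ℝ 2^[ + 2 ℤ.* k ℤ.- + 1 /2]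
oddLimit C₁ C₁>0 k@(+ n)      =
  invℝ C₁ C₁>0 *ℝ 2^[ ℤ.- (+ 6 ℤ.* k ℤ.+ + 5) /2] *ℝ fromℕ (S (2 ℕ.* n ℕ.+ 1))

{-# OPTIONS --safe #-}
module Submission where

-- For a fixed difference z = f − 2m the semigroups with Frobenius number f and
-- multiplicity m can be counted in closed form for large f.  Every nonzero element is
-- at least m, so a sum of two nonzero elements is at least 2m.  If f < 2m, the
-- f − m − 1 bits strictly between m and f are free; f = 2m is impossible; and if
-- f = 2m + z with 0 < z < m, only the bits in [m, m + z] and [2m, 2m + z] are
-- constrained, by conditions that do not depend on m, while the m − z − 1 bits
-- between these blocks are free.  Taking m = z + 1 identifies the number of
-- constrained patterns as S(z), so the count is 2^(m−z−1) S(z).  Dividing by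
-- Fr(f) ~ C 2^(f/2) gives the limits.

open import Data.Integer.Base using (ℤ; +_; _+_; _*_)
open import Data.Product.Base using (_×_)
open import Defs

open import Algebra.Bundles using (AbelianGroup)
open import Data.Bool.Base using (Bool; true; false; T; _∧_; not; if_then_else_)
open import Data.Bool.Properties using (T?; T-∧; T-not-≡)
open import Data.Integer.Base as ℤ using (-[1+_])
import Data.Integer.Properties as ℤ
import Data.Integer.Solver as ℤ
open import Data.List.Base as List using ([]; _∷_; map; mapMaybe; filter; length)
import Data.List.Properties as List
import Data.List.Relation.Unary.All as All
open import Data.Maybe.Base using (Maybe; just; nothing; maybe′)
open import Data.Nat.Base as ℕ using (ℕ; zero; suc; z≤n; s≤s)
import Data.Nat.Properties as ℕ
import Data.Nat.Solver as ℕ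
open import Data.Product.Base using (∃; _,_; proj₁; proj₂)
open import Data.Product.Function.NonDependent.Propositional using (_×-⇔_)
open import Data.Rational.Base as ℚ using (0ℚ; 1ℚ; ½)
import Data.Rational.Properties as ℚ
import Data.Rational.Solver as ℚ
import Data.Rational.Unnormalised.Base as ℚᵘ
import Data.Rational.Unnormalised.Properties as ℚᵘ
open import Data.Sum.Base using (_⊎_; inj₁; inj₂)
open import Data.Vec.Base using (Vec; []; _∷_; _++_; replicate; splitAt)
open import Function.Base using (_∘_)
open import Function.Bundles using (_⇔_; mk⇔; Equivalence)
open import Function.Construct.Composition using (_⇔-∘_)
open import Function.Construct.Identity using (⇔-id)
open import Function.Construct.Symmetry using (⇔-sym)
open import Level using (0ℓ)
open import Relation.Binary.Bundles using (Setoid)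
open import Relation.Binary.PropositionalEquality
import Relation.Binary.Reasoning.Setoid as SetoidReasoning
open import Relation.Nullary using (¬_; Dec; yes; no; does; contradiction)
open import Relation.Nullary.Decidable using (_×-dec_; _→-dec_; ¬?; does-⇔; dec-false)
open import Relation.Unary using (Pred; Decidable)

open import Algebra.Properties.Group (AbelianGroup.group ℤ.+-0-abelianGroup) using (∙-cancelˡ)

-- Counting bit vectors

-- Recursion on the leading bit makes fixing or freeing a block of bits an induction over that
-- block; `length-filter-allVecs` ties it to the enumeration.
count : ∀ {N} → (Vec Bool N → Bool) → ℕ
count {zero}  p = if p [] then 1 else 0
count {suc N} p = count (p ∘ (true ∷_)) ℕ.+ count (p ∘ (false ∷_))

count-cong : ∀ {N} {p q : Vec Bool N → Bool} → (∀ v → p v ≡ q v) → count p ≡ count q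
count-cong {zero}  h = cong (if_then 1 else 0) (h [])
count-cong {suc N} h = cong₂ ℕ._+_ (count-cong (h ∘ (true ∷_))) (count-cong (h ∘ (false ∷_)))

count-none : ∀ {N} {p : Vec Bool N → Bool} → (∀ v → ¬ T (p v)) → count p ≡ 0
count-none {zero}  {p} h with p [] | h []
... | true  | ¬p = contradiction _ ¬p
... | false | _  = refl
count-none {suc N} h = cong₂ ℕ._+_ (count-none (h ∘ (true ∷_))) (count-none (h ∘ (false ∷_)))

length-filter-map : ∀ {A B : Set} {P : Pred B 0ℓ} (P? : Decidable P) (g : A → B) xs →
  length (filter P? (map g xs)) ≡ length (filter (P? ∘ g) xs)
length-filter-map P? g []       = refl
length-filter-map P? g (x ∷ xs) with ih ← length-filter-map P? g xs | does (P? (g x))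
... | true  = cong suc ih
... | false = ih

length-filter-allVecs : ∀ N (p : Vec Bool N → Bool) → length (filter (T? ∘ p) (allVecs N)) ≡ count p
length-filter-allVecs zero    p with p []
... | true  = refl
... | false = refl
length-filter-allVecs (suc N) p = begin
  length (filter (T? ∘ p) (map (true ∷_) vs List.++ map (false ∷_) vs))
    ≡⟨ cong length (List.filter-++ (T? ∘ p) (map (true ∷_) vs) (map (false ∷_) vs)) ⟩
  length (filter (T? ∘ p) (map (true ∷_) vs) List.++ filter (T? ∘ p) (map (false ∷_) vs))
    ≡⟨ List.length-++ (filter (T? ∘ p) (map (true ∷_) vs)) ⟩
  length (filter (T? ∘ p) (map (true ∷_) vs)) ℕ.+ length (filter (T? ∘ p) (map (false ∷_) vs))
    ≡⟨ cong₂ ℕ._+_ (half true) (half false) ⟩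
  count p ∎
  where
  open ≡-Reasoning
  vs = allVecs N
  half : ∀ b → length (filter (T? ∘ p) (map (b ∷_) vs)) ≡ count (p ∘ (b ∷_))
  half b = trans (length-filter-map (T? ∘ p) (b ∷_) vs) (length-filter-allVecs N (p ∘ (b ∷_)))

-- Shaped after the enumeration of semigroups: two filters applied to the successes of a partial map
-- collapse into one Boolean test on the arguments.
length-filter-filter-mapMaybe :
  ∀ {A B : Set} {P Q : Pred B 0ℓ} (P? : Decidable P) (Q? : Decidable Q) (g : A → Maybe B) {p : A → Bool} →
  (∀ x → p x ≡ maybe′ (λ y → does (P? y) ∧ does (Q? y)) false (g x)) →
  ∀ xs → length (filter Q? (filter P? (mapMaybe g xs))) ≡ length (filter (T? ∘ p) xs)
length-filter-filter-mapMaybe P? Q? g h []       = refl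
length-filter-filter-mapMaybe P? Q? g {p} h (x ∷ xs)
  with ih ← length-filter-filter-mapMaybe P? Q? g h xs | g x | p x | h x
... | nothing | _ | refl = ih
... | just y | _ | refl with does (P? y)
...   | false = ih
...   | true with does (Q? y)
...     | false = ih
...     | true  = cong suc ih

-- At each bit of the prefix one of the two halves of the count is empty. This removes the bits that
-- the multiplicity forces.
count-prefix : ∀ {a N} (u₀ : Vec Bool a) {p : Vec Bool (a ℕ.+ N) → Bool} →
  (∀ u w → T (p (u ++ w)) → u ≡ u₀) → count p ≡ count (λ w → p (u₀ ++ w))
count-prefix []           h = refl
count-prefix {suc a} (true ∷ u₀) {p} h = trans (cong₂ ℕ._+_
  (count-prefix u₀ (λ u w t → ∷-injectiveʳ (h (true ∷ u) w t)))
  (count-none none)) (ℕ.+-identityʳ _)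
  where
  none : ∀ v → ¬ T (p (false ∷ v))
  none v t with (u , w , refl) ← splitAt a v with () ← h (false ∷ u) w t
count-prefix {suc a} (false ∷ u₀) {p} h = cong₂ ℕ._+_
  (count-none none)
  (count-prefix u₀ (λ u w t → ∷-injectiveʳ (h (false ∷ u) w t)))
  where
  none : ∀ v → ¬ T (p (true ∷ v))
  none v t with (u , w , refl) ← splitAt a v with () ← h (true ∷ u) w t

-- Each bit of the middle block splits the count into two equal halves, hence the power of 2.
count-free : ∀ a b {c} {p : Vec Bool (a ℕ.+ (b ℕ.+ c)) → Bool} (q : Vec Bool (a ℕ.+ c) → Bool) →
  (∀ (u : Vec Bool a) (v : Vec Bool b) (w : Vec Bool c) → p (u ++ v ++ w) ≡ q (u ++ w)) →
  count p ≡ 2 ℕ.^ b ℕ.* count q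
count-free (suc a) b q h = trans
  (cong₂ ℕ._+_ (count-free a b (q ∘ (true ∷_)) (h ∘ (true ∷_))) (count-free a b (q ∘ (false ∷_)) (h ∘ (false ∷_))))
  (sym (ℕ.*-distribˡ-+ (2 ℕ.^ b) (count (q ∘ (true ∷_))) _))
count-free zero zero    q h = trans (count-cong (h [] [])) (sym (ℕ.+-identityʳ _))
count-free zero (suc b) q h = trans
  (cong₂ ℕ._+_ (count-free zero b q (λ { [] v → h [] (true ∷ v) })) (count-free zero b q (λ { [] v → h [] (false ∷ v) })))
  (trans (sym (ℕ.*-distribʳ-+ (count q) (2 ℕ.^ b) (2 ℕ.^ b)))
    (cong (λ x → (2 ℕ.^ b ℕ.+ x) ℕ.* count q) (sym (ℕ.+-identityʳ _))))

-- Multiplicity and Frobenius number as conditions on bits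

HasInvariants : ℕ → ℕ → (ℕ → Bool) → Set
HasInvariants m f χ = ¬ T (χ f) × T (χ m) × (∀ {n} → n ℕ.< m → n ≢ 0 → ¬ T (χ n))

hasInvariants? : ∀ m f χ → Dec (HasInvariants m f χ)
hasInvariants? m f χ = ¬? (T? (χ f)) ×-dec T? (χ m) ×-dec
  ℕ.allUpTo? (λ n → ¬? (n ℕ.≟ 0) →-dec ¬? (T? (χ n))) m

Admissible : ℕ → ℕ → (ℕ → Bool) → Set
Admissible m f χ = IsSemigroup χ × HasInvariants m f χ

admissible? : ∀ m f {N} (v : Vec Bool N) → Dec (Admissible m f (extend v))
admissible? m f v = isSemigroup? v ×-dec hasInvariants? m f (extend v)

-- The conductor is f + 1. If f were an element, all numbers from f on would be, contradicting
-- minimality of the conductor.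
frobenius-∉ : ∀ {f} Λ → frobenius Λ ≡ + f → ¬ f ∈ₛ Λ
frobenius-∉ {f} Λ eq f∈ = ℕ.<⇒≱ (ℕ.n<1+n f) (subst (ℕ._≤ f) c≡
  (proj₂ (conductor-correct Λ) f λ
    { zero    → subst (_∈ₛ Λ) (sym (ℕ.+-identityʳ f)) f∈
    ; (suc n) → subst (_∈ₛ Λ) (trans (cong (ℕ._+ n) c≡) (sym (ℕ.+-suc f n))) (proj₁ (conductor-correct Λ) n) }))
  where
  suc-pred : ∀ c → + c ℤ.- + 1 ≡ + f → c ≡ suc f
  suc-pred (suc c) refl = refl
  c≡ : conductor Λ ≡ suc f
  c≡ = suc-pred (conductor Λ) eq

hasInvariants⇔ : ∀ {m f} Λ → m ≢ 0 → (∀ n → f ℕ.< n → n ∈ₛ Λ) →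
  HasInvariants m f (member Λ) ⇔ (frobenius Λ ≡ + f × multiplicity Λ ≡ m)
hasInvariants⇔ {m} {f} Λ m≢0 tail = mk⇔
  (λ (f∉ , m∈ , below) → cong (λ c → + c ℤ.- + 1) (conductor≡ f∉) ,
    ℕ.≤-antisym (proj₂ (multiplicity-correct Λ) m m∈ m≢0)
      (ℕ.≮⇒≥ λ lt → below lt (λ ()) (proj₁ (proj₁ (multiplicity-correct Λ)))))
  λ { (eq , refl) → frobenius-∉ Λ eq , proj₁ (proj₁ (multiplicity-correct Λ)) ,
    λ lt n≢0 n∈ → ℕ.<⇒≱ lt (proj₂ (multiplicity-correct Λ) _ n∈ n≢0) }
  where
  conductor≡ : ¬ f ∈ₛ Λ → conductor Λ ≡ suc f
  conductor≡ f∉ = ℕ.≤-antisym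
    (proj₂ (conductor-correct Λ) (suc f) λ n → tail _ (s≤s (ℕ.m≤m+n f n)))
    (ℕ.≰⇒> λ c≤f → f∉ (subst (_∈ₛ Λ) (ℕ.m+[n∸m]≡n c≤f) (proj₁ (conductor-correct Λ) _)))

-- Turns the enumeration into a count of bit vectors. `Q` is left open because the multiplicity is
-- prescribed in two ways: through f - 2m, and directly in `S`.
length-filter-withFrobenius : ∀ {m f} {Q : Pred NumericalSemigroup 0ℓ} (Q? : Decidable Q) →
  m ≢ 0 → (∀ Λ → multiplicity Λ ≡ m ⇔ Q Λ) →
  length (filter Q? (withFrobenius f)) ≡ count {suc f} (does ∘ admissible? m f)
length-filter-withFrobenius {m} {f} Q? m≢0 Q⇔ = trans
  (length-filter-filter-mapMaybe (λ Λ → frobenius Λ ℤ.≟ + f) Q? toSemigroup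
    (λ v → decides v (admissible? m f v)) (allVecs (suc f)))
  (length-filter-allVecs (suc f) _)
  where
  decides : ∀ (v : Vec Bool (suc f)) (a? : Dec (Admissible m f (extend v))) →
    does a? ≡ maybe′ (λ Λ → does (frobenius Λ ℤ.≟ + f) ∧ does (Q? Λ)) false (toSemigroup v)
  decides v a? with isSemigroup? v
  ... | no ¬s = dec-false a? (¬s ∘ proj₁)
  ... | yes s@(0∈v , +-cl) = does-⇔
    (mk⇔ (to ∘ proj₂) (λ x → s , from x)) a? ((frobenius Λ ℤ.≟ + f) ×-dec Q? Λ)
    where
    Λ : NumericalSemigroup
    Λ = record { member = extend v ; 0∈ = 0∈v ; +-closed = +-cl ; cofinite = suc f , extend-large v }
    open Equivalence ((⇔-id _ ×-⇔ Q⇔ Λ) ⇔-∘ hasInvariants⇔ {m} {f} Λ m≢0 (extend-large v))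

-- Semigroups by blocks of bits

extend-++ˡ : ∀ {a b} (u : Vec Bool a) (w : Vec Bool b) {n} → n ℕ.< a → extend (u ++ w) n ≡ extend u n
extend-++ˡ (x ∷ u) w {zero}  _         = refl
extend-++ˡ (x ∷ u) w {suc n} (s≤s n<a) = extend-++ˡ u w n<a

extend-++ʳ : ∀ {a b} (u : Vec Bool a) (w : Vec Bool b) n → extend (u ++ w) (a ℕ.+ n) ≡ extend w n
extend-++ʳ []      w n = refl
extend-++ʳ (x ∷ u) w n = extend-++ʳ u w n

¬T⇒≡false : ∀ {b} → ¬ T b → b ≡ false
¬T⇒≡false {true}  ¬t = contradiction _ ¬t
¬T⇒≡false {false} _  = refl

does⇒ : ∀ {A : Set} (a? : Dec A) → T (does a?) → A
does⇒ (yes a) _ = a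

-- The bits at 0, ..., m of a semigroup of multiplicity m + 1. The shift makes every multiplicity
-- positive by construction.
gap : ∀ m → Vec Bool (suc m)
gap m = true ∷ replicate m false

gap-∉ : ∀ m {b} (w : Vec Bool b) {n} → n ℕ.< suc m → n ≢ 0 → ¬ T (extend (gap m ++ w) n)
gap-∉ m w {zero}  _         n≢0 = contradiction refl n≢0
gap-∉ m w {suc n} (s≤s n<m) _   = go m n<m
  where
  go : ∀ m {n} → n ℕ.< m → ¬ T (extend (replicate m false ++ w) n)
  go (suc m) {suc n} (s≤s n<m) = go m n<m

admissible⇒gap : ∀ {m f b} (u : Vec Bool (suc m)) (w : Vec Bool b) →
  Admissible (suc m) f (extend (u ++ w)) → u ≡ gap m
admissible⇒gap {m} u w ((0∈ , _) , _ , _ , below) = extend-injective u (gap m) agree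
  where
  agree : ∀ n → extend u n ≡ extend (gap m) n
  agree n with n ℕ.<? suc m
  ... | no n≮ = trans (T⇒≡true (extend-large u n (ℕ.≮⇒≥ n≮))) (sym (T⇒≡true (extend-large (gap m) n (ℕ.≮⇒≥ n≮))))
  agree zero    | yes n< = trans (sym (extend-++ˡ u w n<)) (T⇒≡true 0∈)
  agree (suc n) | yes n< = trans (sym (extend-++ˡ u w n<)) (trans (¬T⇒≡false (below n< λ ()))
    (trans (sym (¬T⇒≡false (gap-∉ m w n< λ ()))) (extend-++ˡ (gap m) w n<)))

count-gap : ∀ {m f N b} → N ≡ suc m ℕ.+ b → count {N} (does ∘ admissible? (suc m) f) ≡
  count {b} (λ w → does (admissible? (suc m) f (gap m ++ w)))
count-gap {m} {f} refl = count-prefix (gap m) {does ∘ admissible? (suc m) f}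
  λ u w t → admissible⇒gap u w (does⇒ (admissible? (suc m) f (u ++ w)) t)

-- Sums with 0 are harmless, and every nonzero element is m + i for some i, so closure has to be
-- checked only from 2m on.
gap-isSemigroup : ∀ {m χ} → T (χ 0) → (∀ {n} → n ℕ.< m → n ≢ 0 → ¬ T (χ n)) →
  (∀ i j → T (χ (m ℕ.+ i)) → T (χ (m ℕ.+ j)) → T (χ (m ℕ.+ m ℕ.+ (i ℕ.+ j)))) → IsSemigroup χ
gap-isSemigroup {m} {χ} 0∈ below closed = 0∈ , +-cl
  where
  open ℕ.+-*-Solver
  split : ∀ n → T (χ n) → n ≡ 0 ⊎ ∃ λ i → n ≡ m ℕ.+ i
  split n n∈ with n ℕ.≟ 0 | n ℕ.<? m
  ... | yes n≡0 | _      = inj₁ n≡0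
  ... | no n≢0  | yes n< = contradiction n∈ (below n< n≢0)
  ... | no _    | no n≮  = inj₂ (n ℕ.∸ m , sym (ℕ.m+[n∸m]≡n (ℕ.≮⇒≥ n≮)))
  +-cl : ∀ p q → T (χ p) → T (χ q) → T (χ (p ℕ.+ q))
  +-cl p q p∈ q∈ with split p p∈ | split q q∈
  ... | inj₁ refl       | _               = q∈
  ... | inj₂ _          | inj₁ refl       = subst (T ∘ χ) (sym (ℕ.+-identityʳ p)) p∈
  ... | inj₂ (i , refl) | inj₂ (j , refl) = subst (T ∘ χ)
    (solve 3 (λ m i j → m :+ m :+ (i :+ j) := m :+ i :+ (m :+ j)) refl m i j) (closed i j p∈ q∈)

-- `x` and `y` are the bits at the multiplicity m + 1 and at f = m + b + 2, and `v` is the block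
-- strictly between. Closure holds by itself, because sums of two nonzero elements exceed f.
admissible⇔-f<2m : ∀ {m b x y} (v : Vec Bool b) → b ℕ.< m →
  Admissible (suc m) (suc m ℕ.+ suc b) (extend (gap m ++ x ∷ v ++ y ∷ [])) ⇔ T (x ∧ not y)
admissible⇔-f<2m {m} {b} {x} {y} v b<m = mk⇔ to from
  where
  w = x ∷ v ++ y ∷ []
  χ = extend (gap m ++ w)
  at-m : χ (suc m) ≡ x
  at-m = trans (cong χ (sym (ℕ.+-identityʳ (suc m)))) (extend-++ʳ (gap m) w 0)
  at-f : χ (suc m ℕ.+ suc b) ≡ y
  at-f = trans (extend-++ʳ (gap m) w (suc b))
    (trans (cong (extend (v ++ y ∷ [])) (sym (ℕ.+-identityʳ b))) (extend-++ʳ v (y ∷ []) 0))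
  to : Admissible (suc m) (suc m ℕ.+ suc b) χ → T (x ∧ not y)
  to (_ , f∉ , m∈ , _) = Equivalence.from T-∧
    (subst T at-m m∈ , Equivalence.from T-not-≡ (¬T⇒≡false (f∉ ∘ subst T (sym at-f))))
  -- The bits after the gap number b + 2 ≤ m + 1, so position 2(m + 1) already lies past the vector,
  -- where `extend` is true.
  closed : ∀ i j → T (χ (suc m ℕ.+ suc m ℕ.+ (i ℕ.+ j)))
  closed i j = subst (T ∘ χ) (sym (ℕ.+-assoc (suc m) (suc m) (i ℕ.+ j)))
    (subst T (sym (extend-++ʳ (gap m) w (suc m ℕ.+ (i ℕ.+ j))))
      (extend-large w _ (ℕ.≤-trans (subst (ℕ._≤ suc m) (cong suc (ℕ.+-comm 1 b)) (s≤s b<m)) (ℕ.m≤m+n (suc m) (i ℕ.+ j)))))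
  from : T (x ∧ not y) → Admissible (suc m) (suc m ℕ.+ suc b) χ
  from t = let (x∈ , y∉) = Equivalence.to T-∧ t in
    gap-isSemigroup {suc m} _ (gap-∉ m w) (λ i j _ _ → closed i j) ,
    subst T (trans at-f (Equivalence.to T-not-≡ y∉)) , subst T (sym at-m) x∈ , gap-∉ m w

-- With a and c the bits from m and from 2m on, the condition on a semigroup of
-- multiplicity m and Frobenius number 2m + z, z < m.
Compatible : ℕ → (a c : ℕ → Bool) → Set
Compatible z a c = T (a 0) × ¬ T (c z) × (∀ i j → i ℕ.+ j ℕ.≤ z → T (a i) → T (a j) → T (c (i ℕ.+ j)))

-- With M = m + 1, the blocks `u`, `v`, `w` start at M, M + z + 1 and 2M. A sum of two nonzero
-- elements is 2M + (i + j). If i + j > z it exceeds the Frobenius number; otherwise i, j ≤ z and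
-- only `u` and `w` are involved. Hence `v` is free.
admissible⇔compatible : ∀ {m z b} → m ≡ z ℕ.+ b →
  (u : Vec Bool (suc z)) (v : Vec Bool b) (w : Vec Bool (suc z)) →
  Admissible (suc m) (suc m ℕ.+ suc m ℕ.+ z) (extend (gap m ++ u ++ v ++ w)) ⇔ Compatible z (extend u) (extend w)
admissible⇔compatible {m} {z} {b} refl u v w = mk⇔ to from
  where
  M = suc m
  r = u ++ v ++ w
  χ = extend (gap m ++ r)
  at-m+ : ∀ {i} → i ℕ.≤ z → χ (M ℕ.+ i) ≡ extend u i
  at-m+ {i} i≤z = trans (extend-++ʳ (gap m) r i) (extend-++ˡ u (v ++ w) (s≤s i≤z))
  at-m : χ M ≡ extend u 0
  at-m = trans (cong χ (sym (ℕ.+-identityʳ M))) (at-m+ z≤n)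
  at-2m+ : ∀ i → χ (M ℕ.+ M ℕ.+ i) ≡ extend w i
  at-2m+ i = begin
    χ (M ℕ.+ M ℕ.+ i)                    ≡⟨ cong χ (ℕ.+-assoc M M i) ⟩
    χ (M ℕ.+ (M ℕ.+ i))                  ≡⟨ extend-++ʳ (gap m) r (M ℕ.+ i) ⟩
    extend r (M ℕ.+ i)                   ≡⟨ cong (extend r) (ℕ.+-assoc (suc z) b i) ⟩
    extend r (suc z ℕ.+ (b ℕ.+ i))       ≡⟨ extend-++ʳ u (v ++ w) (b ℕ.+ i) ⟩
    extend (v ++ w) (b ℕ.+ i)            ≡⟨ extend-++ʳ v w i ⟩
    extend w i                           ∎
    where open ≡-Reasoning
  to : Admissible M (M ℕ.+ M ℕ.+ z) χ → Compatible z (extend u) (extend w)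
  to ((_ , closed) , f∉ , m∈ , _) = subst T at-m m∈ , f∉ ∘ subst T (sym (at-2m+ z)) ,
    λ i j i+j≤z i∈ j∈ → subst T (trans (cong χ (regroup i j)) (at-2m+ (i ℕ.+ j))) (closed (M ℕ.+ i) (M ℕ.+ j)
      (subst T (sym (at-m+ (ℕ.m+n≤o⇒m≤o i i+j≤z))) i∈) (subst T (sym (at-m+ (ℕ.m+n≤o⇒n≤o i i+j≤z))) j∈))
    where
    open ℕ.+-*-Solver
    regroup : ∀ i j → M ℕ.+ i ℕ.+ (M ℕ.+ j) ≡ M ℕ.+ M ℕ.+ (i ℕ.+ j)
    regroup = solve 3 (λ m i j → m :+ i :+ (m :+ j) := m :+ m :+ (i :+ j)) refl M
  from : Compatible z (extend u) (extend w) → Admissible M (M ℕ.+ M ℕ.+ z) χ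
  from (0∈u , z∉w , u+u⊆w) = gap-isSemigroup {M} _ (gap-∉ m r) closed ,
    z∉w ∘ subst T (at-2m+ z) , subst T (sym at-m) 0∈u , gap-∉ m r
    where
    closed : ∀ i j → T (χ (M ℕ.+ i)) → T (χ (M ℕ.+ j)) → T (χ (M ℕ.+ M ℕ.+ (i ℕ.+ j)))
    closed i j i∈ j∈ with i ℕ.+ j ℕ.≤? z
    ... | no ≰z  = subst T (sym (at-2m+ _)) (extend-large w _ (ℕ.≰⇒> ≰z))
    ... | yes ≤z = subst T (sym (at-2m+ _)) (u+u⊆w i j ≤z
      (subst T (at-m+ (ℕ.m+n≤o⇒m≤o i ≤z)) i∈) (subst T (at-m+ (ℕ.m+n≤o⇒n≤o i ≤z)) j∈))

-- The number of semigroups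

#[f-2m≡_] : ℤ → ℕ → ℕ
#[f-2m≡ z ] f = length (filter (λ Λ → + f ℤ.- + 2 * + multiplicity Λ ℤ.≟ z) (withFrobenius f))

-- For fixed f the difference f - 2m determines m, so prescribing it amounts to prescribing the
-- multiplicity.
#[f-2m]≡count : ∀ {m f z} → + f ℤ.- + 2 * + suc m ≡ z →
  #[f-2m≡ z ] f ≡ count {suc f} (does ∘ admissible? (suc m) f)
#[f-2m]≡count {m} {f} refl = length-filter-withFrobenius {suc m} {f} (λ Λ → + f ℤ.- + 2 * + multiplicity Λ ℤ.≟ _) (λ ())
  λ Λ → mk⇔ (cong (λ n → + f ℤ.- + 2 * + n)) λ eq →
    ℤ.+-injective (ℤ.*-cancelˡ-≡ (+ 2) _ _ (ℤ.neg-injective (∙-cancelˡ (+ f) _ _ eq)))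

#[f<2m] : ∀ {m f z} b → b ℕ.< m → f ≡ suc m ℕ.+ suc b → + f ℤ.- + 2 * + suc m ≡ z →
  #[f-2m≡ z ] f ≡ 2 ℕ.^ b
#[f<2m] {m} {f} b b<m refl eq = begin
  #[f-2m≡ _ ] f
    ≡⟨ #[f-2m]≡count {m} {f} eq ⟩
  count {suc f} (does ∘ admissible? (suc m) f)
    ≡⟨ count-gap {m} {f} {b = 1 ℕ.+ (b ℕ.+ 1)}
         (solve 2 (λ m b → con 1 :+ (con 1 :+ m :+ (con 1 :+ b)) := con 1 :+ m :+ (con 1 :+ (b :+ con 1))) refl m b) ⟩
  count p
    ≡⟨ count-free 1 b {p = p} q (λ { (x ∷ []) v (y ∷ []) → does-⇔ (admissible⇔-f<2m {x = x} v b<m)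
         (admissible? (suc m) f (gap m ++ x ∷ v ++ y ∷ [])) (T? (x ∧ not y)) }) ⟩
  -- Exactly one of the four choices for the bits at the multiplicity and at f is allowed, so
  -- `count q` evaluates to 1.
  2 ℕ.^ b ℕ.* 1
    ≡⟨ ℕ.*-identityʳ (2 ℕ.^ b) ⟩
  2 ℕ.^ b ∎
  where
  open ≡-Reasoning
  open ℕ.+-*-Solver
  p : Vec Bool (1 ℕ.+ (b ℕ.+ 1)) → Bool
  p w = does (admissible? (suc m) f (gap m ++ w))
  q : Vec Bool 2 → Bool
  q (x ∷ y ∷ []) = x ∧ not y

#[f>2m] : ∀ {m f z} j b → m ≡ j ℕ.+ b → f ≡ suc m ℕ.+ suc m ℕ.+ j → + f ℤ.- + 2 * + suc m ≡ z →
  #[f-2m≡ z ] f ≡ 2 ℕ.^ b ℕ.* S j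
#[f>2m] {m} {f} j b refl refl eq = begin
  #[f-2m≡ _ ] f
    ≡⟨ #[f-2m]≡count {m} {f} eq ⟩
  count {suc f} (does ∘ admissible? (suc m) f)
    ≡⟨ count-gap {m} {f} {b = suc j ℕ.+ (b ℕ.+ suc j)}
         (solve 2 (λ j b → con 1 :+ (con 1 :+ (j :+ b) :+ (con 1 :+ (j :+ b)) :+ j) :=
           con 1 :+ (j :+ b) :+ (con 1 :+ j :+ (b :+ (con 1 :+ j)))) refl j b) ⟩
  count p
    -- Both sides reduce to the same `Compatible` condition. The semigroups counted by `S j` are the
    -- case of multiplicity j + 1, where the free block is empty.
    ≡⟨ count-free (suc j) b {p = p} q (λ u v w → does-⇔
         (⇔-sym (admissible⇔compatible (sym (ℕ.+-identityʳ j)) u [] w) ⇔-∘ admissible⇔compatible refl u v w)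
         (admissible? (suc m) f (gap m ++ u ++ v ++ w)) (admissible? (suc j) f₀ (gap j ++ u ++ w))) ⟩
  2 ℕ.^ b ℕ.* count q
    ≡⟨ cong (2 ℕ.^ b ℕ.*_) (sym S≡) ⟩
  2 ℕ.^ b ℕ.* S j ∎
  where
  open ≡-Reasoning
  open ℕ.+-*-Solver
  f₀ = suc j ℕ.+ suc j ℕ.+ j
  p : Vec Bool (suc j ℕ.+ (b ℕ.+ suc j)) → Bool
  p w = does (admissible? (suc m) f (gap m ++ w))
  q : Vec Bool (suc j ℕ.+ suc j) → Bool
  q w = does (admissible? (suc j) f₀ (gap j ++ w))
  f₀≡ : 3 ℕ.* j ℕ.+ 2 ≡ f₀
  f₀≡ = solve 1 (λ j → con 3 :* j :+ con 2 := con 1 :+ j :+ (con 1 :+ j) :+ j) refl j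
  S≡ : S j ≡ count q
  S≡ = begin
    S j
      ≡⟨ cong (length ∘ filter (λ Λ → multiplicity Λ ℕ.≟ j ℕ.+ 1) ∘ withFrobenius) f₀≡ ⟩
    length (filter (λ Λ → multiplicity Λ ℕ.≟ j ℕ.+ 1) (withFrobenius f₀))
      ≡⟨ length-filter-withFrobenius {suc j} {f₀} (λ Λ → multiplicity Λ ℕ.≟ j ℕ.+ 1) (λ ())
           (λ Λ → mk⇔ (λ e → trans e (ℕ.+-comm 1 j)) (λ e → trans e (ℕ.+-comm j 1))) ⟩
    count {suc f₀} (does ∘ admissible? (suc j) f₀)
      ≡⟨ count-gap {j} {f₀} {b = suc j ℕ.+ suc j}
           (solve 1 (λ j → con 1 :+ (con 1 :+ j :+ (con 1 :+ j) :+ j) := con 1 :+ j :+ (con 1 :+ j :+ (con 1 :+ j))) refl j) ⟩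
    count q ∎

-- Twice the multiplicity is an element, whereas the Frobenius number is not.
#[f=2m] : ∀ f → #[f-2m≡ + 0 ] f ≡ 0
#[f=2m] f = cong length (List.filter-none (λ Λ → + f ℤ.- + 2 * + multiplicity Λ ℤ.≟ + 0)
  (All.tabulate λ {Λ} Λ∈ eq → frobenius-∉ Λ (withFrobenius-sound f Λ∈) (subst (_∈ₛ Λ) (sym (f≡2m Λ eq)) (2m∈ Λ))))
  where
  f≡2m : ∀ Λ → + f ℤ.- + 2 * + multiplicity Λ ≡ + 0 → f ≡ 2 ℕ.* multiplicity Λ
  f≡2m Λ eq = ℤ.+-injective (trans (ℤ.i-j≡0⇒i≡j (+ f) (+ 2 * + multiplicity Λ) eq) (sym (ℤ.pos-* 2 (multiplicity Λ))))
  2m∈ : ∀ Λ → 2 ℕ.* multiplicity Λ ∈ₛ Λ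
  2m∈ Λ = let m∈ = proj₁ (proj₁ (multiplicity-correct Λ)) in
    subst (_∈ₛ Λ) (cong (multiplicity Λ ℕ.+_) (sym (ℕ.+-identityʳ _))) (+-closed Λ _ _ m∈ m∈)

-- Uniform probabilities as rational quotients

fromℚᵘ-* : ∀ p q → ℚ.fromℚᵘ p ℚ.* ℚ.fromℚᵘ q ≡ ℚ.fromℚᵘ (p ℚᵘ.* q)
fromℚᵘ-* p q = ℚ.toℚᵘ-injective (begin
  ℚ.toℚᵘ (ℚ.fromℚᵘ p ℚ.* ℚ.fromℚᵘ q)              ≈⟨ ℚ.toℚᵘ-homo-* (ℚ.fromℚᵘ p) (ℚ.fromℚᵘ q) ⟩
  ℚ.toℚᵘ (ℚ.fromℚᵘ p) ℚᵘ.* ℚ.toℚᵘ (ℚ.fromℚᵘ q)    ≈⟨ ℚᵘ.*-cong (ℚ.toℚᵘ-fromℚᵘ p) (ℚ.toℚᵘ-fromℚᵘ q) ⟩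
  p ℚᵘ.* q                                        ≈⟨ ℚ.toℚᵘ-fromℚᵘ (p ℚᵘ.* q) ⟨
  ℚ.toℚᵘ (ℚ.fromℚᵘ (p ℚᵘ.* q))                    ∎)
  where open SetoidReasoning ℚᵘ.≃-setoid

/1-* : ∀ a b → + (a ℕ.* b) ℚ./ 1 ≡ (+ a ℚ./ 1) ℚ.* (+ b ℚ./ 1)
/1-* a b = sym (trans (fromℚᵘ-* (ℚᵘ.mkℚᵘ (+ a) 0) (ℚᵘ.mkℚᵘ (+ b) 0))
  (cong (ℚ._/ 1) (sym (ℤ.pos-* a b))))

module _ {A : Set} {P : Pred A 0ℓ} (P? : Decidable P) where

  -- The definition with the denominator cleared. It also covers the empty list, where both sides
  -- are 0.
  uniformℙ-*-length : ∀ xs → uniformℙ xs P? ℚ.* (+ length xs ℚ./ 1) ≡ + length (filter P? xs) ℚ./ 1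
  uniformℙ-*-length []          = refl
  uniformℙ-*-length xs@(_ ∷ ys) = trans (fromℚᵘ-* (ℚᵘ.mkℚᵘ (+ k) (length ys)) (ℚᵘ.mkℚᵘ (+ length xs) 0))
    (ℚ.fromℚᵘ-cong {ℚᵘ.mkℚᵘ (+ k) (length ys) ℚᵘ.* ℚᵘ.mkℚᵘ (+ length xs) 0} {ℚᵘ.mkℚᵘ (+ k) 0}
      (ℚᵘ.*≡* (trans (ℤ.*-identityʳ (+ k * + length xs))
      (cong (λ d → + k * + d) (sym (ℕ.*-identityʳ (length xs)))))))
    where k = length (filter P? xs)

  0≤uniformℙ : ∀ xs → 0ℚ ℚ.≤ uniformℙ xs P?
  0≤uniformℙ []          = ℚ.≤-refl
  0≤uniformℙ xs@(_ ∷ ys) = ℚ.toℚᵘ-cancel-≤ (ℚᵘ.≤-respʳ-≃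
    (ℚᵘ.≃-sym (ℚ.toℚᵘ-fromℚᵘ (ℚᵘ.mkℚᵘ (+ k) (length ys))))
    (ℚᵘ.*≤* (subst (ℤ._≤_ (+ 0)) (sym (ℤ.*-identityʳ (+ k))) (ℤ.+≤+ z≤n))))
    where k = length (filter P? xs)

  uniformℙ≤1 : ∀ xs → uniformℙ xs P? ℚ.≤ 1ℚ
  uniformℙ≤1 []          = ℚ.<⇒≤ 0<1
  uniformℙ≤1 xs@(_ ∷ ys) = ℚ.toℚᵘ-cancel-≤ (ℚᵘ.≤-respˡ-≃
    (ℚᵘ.≃-sym (ℚ.toℚᵘ-fromℚᵘ (ℚᵘ.mkℚᵘ (+ k) (length ys))))
    (ℚᵘ.*≤* (subst₂ ℤ._≤_ (sym (ℤ.*-identityʳ (+ k))) (sym (ℤ.*-identityˡ (+ length xs)))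
      (ℤ.+≤+ (List.length-filter P? xs)))))
    where k = length (filter P? xs)

-- Equality of reals

pointwise⇒≈ : ∀ {x y} → (∀ n → seq x n ≡ seq y n) → x ≈ℝ y
pointwise⇒≈ {x} {y} h ε 0<ε = 0 , λ n _ → subst (λ q → ℚ.∣ q ℚ.- seq y n ∣ ℚ.< ε) (sym (h n)) (∣p-p∣<ε (seq y n) 0<ε)

≈ℝ-sym : ∀ {x y} → x ≈ℝ y → y ≈ℝ x
≈ℝ-sym {x} {y} x≈y ε 0<ε = let (N , h) = x≈y ε 0<ε in
  N , λ n n≥ → subst (ℚ._< ε) (∣p-q∣≡∣q-p∣ (seq x n) (seq y n)) (h n n≥)

≈ℝ-trans : ∀ {x y z} → x ≈ℝ y → y ≈ℝ z → x ≈ℝ z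
≈ℝ-trans {x} {y} {z} x≈y y≈z ε 0<ε =
  let (N , hx) = x≈y (½ ℚ.* ε) (0<½* 0<ε)
      (M , hz) = y≈z (½ ℚ.* ε) (0<½* 0<ε)
  in N ℕ.⊔ M , λ n n≥ → ℚ.≤-<-trans
    (subst (λ q → ℚ.∣ q ∣ ℚ.≤ ℚ.∣ seq x n ℚ.- seq y n ∣ ℚ.+ ℚ.∣ seq y n ℚ.- seq z n ∣)
      (solve 3 (λ a b c → (a :- b) :+ (b :- c) := a :- c) refl (seq x n) (seq y n) (seq z n))
      (ℚ.∣p+q∣≤∣p∣+∣q∣ (seq x n ℚ.- seq y n) (seq y n ℚ.- seq z n)))
    (+-halves (hx n (≤⊔ˡ n≥)) (hz n (≤⊔ʳ {N} n≥)))
  where open ℚ.+-*-Solver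

ℝ-setoid : Setoid 0ℓ 0ℓ
ℝ-setoid = record
  { Carrier = ℝ
  ; _≈_ = _≈ℝ_
  ; isEquivalence = record
    { refl  = λ {x} → pointwise⇒≈ {x} {x} λ _ → refl
    ; sym   = λ {x} {y} → ≈ℝ-sym {x} {y}
    ; trans = λ {x} {y} {z} → ≈ℝ-trans {x} {y} {z}
    }
  }

module ≈ℝ-Reasoning = SetoidReasoning ℝ-setoid

-- The sequence of `x` is eventually bounded by some B > 0, so closeness of `y` and `z` within ε/B
-- suffices.
*ℝ-congˡ : ∀ x {y z} → y ≈ℝ z → x *ℝ y ≈ℝ x *ℝ z
*ℝ-congˡ x {y} {z} y≈z ε 0<ε =
  let (B , 0<B , N , hB) = seq-bounded x
      (M , h) = y≈z (recip B ℚ.* ε) (*-pos (recip-pos 0<B) 0<ε)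
  in N ℕ.⊔ M , λ n n≥ → subst₂ ℚ._<_
    (trans (sym (ℚ.∣p*q∣≡∣p∣*∣q∣ (seq x n) (seq y n ℚ.- seq z n)))
      (cong ℚ.∣_∣ (solve 3 (λ a b c → a :* (b :- c) := a :* b :- a :* c) refl (seq x n) (seq y n) (seq z n))))
    (*-recip-cancel ε 0<B)
    (*-mono-≤-< (ℚ.0≤∣p∣ (seq y n ℚ.- seq z n)) 0<B (hB n (≤⊔ˡ n≥)) (h n (≤⊔ʳ {N} n≥)))
  where open ℚ.+-*-Solver

*ℝ-comm : ∀ x y → x *ℝ y ≈ℝ y *ℝ x
*ℝ-comm x y = pointwise⇒≈ {x *ℝ y} {y *ℝ x} λ n → ℚ.*-comm (seq x n) (seq y n)

*ℝ-congʳ : ∀ x {y z} → y ≈ℝ z → y *ℝ x ≈ℝ z *ℝ x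
*ℝ-congʳ x {y} {z} y≈z = begin
  y *ℝ x ≈⟨ *ℝ-comm y x ⟩
  x *ℝ y ≈⟨ *ℝ-congˡ x {y} {z} y≈z ⟩
  x *ℝ z ≈⟨ *ℝ-comm x z ⟩
  z *ℝ x ∎
  where open ≈ℝ-Reasoning

-- Powers of √2

½ℝ 1/√2 : ℝ
½ℝ   = invℝ 2ℝ 2>0
1/√2 = invℝ √2 √2>0

√2-seq-recip : ∀ n → √2-seq n ℚ.* recip (√2-seq n) ≡ 1ℚ
√2-seq-recip n = *-recip (ℚ.<-≤-trans 0<1 (1≤√2-seq n))

-- The square of `√2` is 2 only in the limit, while `√2-seq n` times its reciprocal is exactly 1. So
-- a factor 2 · ½ is inserted, its 2 is replaced by the square of `√2`, and the rest cancels
-- termwise.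
1/√2*1/√2≈½ : 1/√2 *ℝ 1/√2 ≈ℝ ½ℝ
1/√2*1/√2≈½ = begin
  1/√2 *ℝ 1/√2                      ≈⟨ pointwise⇒≈ {1/√2 *ℝ 1/√2} {1/√2 *ℝ 1/√2 *ℝ (2ℝ *ℝ ½ℝ)} (λ n → sym (ℚ.*-identityʳ _)) ⟩
  1/√2 *ℝ 1/√2 *ℝ (2ℝ *ℝ ½ℝ)        ≈⟨ *ℝ-congˡ (1/√2 *ℝ 1/√2) {2ℝ *ℝ ½ℝ} {√2 *ℝ √2 *ℝ ½ℝ}
                                         (*ℝ-congʳ ½ℝ {2ℝ} {√2 *ℝ √2} (≈ℝ-sym {√2 *ℝ √2} {2ℝ} √2*√2≈2)) ⟩
  1/√2 *ℝ 1/√2 *ℝ (√2 *ℝ √2 *ℝ ½ℝ)  ≈⟨ pointwise⇒≈ {1/√2 *ℝ 1/√2 *ℝ (√2 *ℝ √2 *ℝ ½ℝ)} {½ℝ} cancel ⟩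
  ½ℝ                                ∎
  where
  open ≈ℝ-Reasoning
  open ℚ.+-*-Solver
  cancel : ∀ n → let s = √2-seq n ; r = recip s in r ℚ.* r ℚ.* (s ℚ.* s ℚ.* recip 2ℚ) ≡ recip 2ℚ
  cancel n = let s = √2-seq n ; r = recip s in trans
    (solve 3 (λ s r h → r :* r :* (s :* s :* h) := (s :* r) :* ((s :* r) :* h)) refl s r (recip 2ℚ))
    (trans (cong (λ q → q ℚ.* (q ℚ.* recip 2ℚ)) (√2-seq-recip n)) refl)

^ℝ-double : ∀ {r h} → r *ℝ r ≈ℝ h → ∀ d → r ^ℝ (d ℕ.+ d) ≈ℝ h ^ℝ d
^ℝ-double         r²≈h zero    = pointwise⇒≈ {1ℝ} {1ℝ} λ _ → refl
^ℝ-double {r} {h} r²≈h (suc d) = subst (λ e → r ^ℝ suc e ≈ℝ h ^ℝ suc d) (sym (ℕ.+-suc d d)) (begin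
  r *ℝ (r *ℝ x)   ≈⟨ pointwise⇒≈ {r *ℝ (r *ℝ x)} {r *ℝ r *ℝ x} (λ n → sym (ℚ.*-assoc (seq r n) (seq r n) (seq x n))) ⟩
  r *ℝ r *ℝ x     ≈⟨ *ℝ-congʳ x {r *ℝ r} {h} r²≈h ⟩
  h *ℝ x          ≈⟨ *ℝ-congˡ h {x} {h ^ℝ d} (^ℝ-double {r} {h} r²≈h d) ⟩
  h *ℝ h ^ℝ d     ∎)
  where
  open ≈ℝ-Reasoning
  x = r ^ℝ (d ℕ.+ d)

-- Two factors `r` multiply to `h`, which absorbs one factor `a`. For r = 1/√2 and a = 2 this
-- cancels 2^b against 2^(-b).
^ℝ-double-cancel : ∀ {r h} a → r *ℝ r ≈ℝ h → (∀ n → seq h n ℚ.* (+ a ℚ./ 1) ≡ 1ℚ) → ∀ b e c →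
  r ^ℝ (b ℕ.+ b ℕ.+ e) *ℝ fromℕ (a ℕ.^ b ℕ.* c) ≈ℝ r ^ℝ e *ℝ fromℕ c
^ℝ-double-cancel {r} a r²≈h ha≡1 zero e c = pointwise⇒≈ {r ^ℝ e *ℝ fromℕ (c ℕ.+ 0)} {r ^ℝ e *ℝ fromℕ c}
  λ n → cong (λ c → seq (r ^ℝ e) n ℚ.* (+ c ℚ./ 1)) (ℕ.+-identityʳ c)
^ℝ-double-cancel {r} {h} a r²≈h ha≡1 (suc b) e c =
  subst₂ (λ d k → r ^ℝ suc (d ℕ.+ e) *ℝ fromℕ k ≈ℝ r ^ℝ e *ℝ fromℕ c)
    (sym (ℕ.+-suc b b)) (sym (ℕ.*-assoc a (a ℕ.^ b) c)) (begin
  r *ℝ (r *ℝ x) *ℝ fromℕ (a ℕ.* k)   ≈⟨ pointwise⇒≈ {r *ℝ (r *ℝ x) *ℝ fromℕ (a ℕ.* k)} {r *ℝ r *ℝ (fromℕ a *ℝ y)} regroup ⟩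
  r *ℝ r *ℝ (fromℕ a *ℝ y)           ≈⟨ *ℝ-congʳ (fromℕ a *ℝ y) {r *ℝ r} {h} r²≈h ⟩
  h *ℝ (fromℕ a *ℝ y)                ≈⟨ pointwise⇒≈ {h *ℝ (fromℕ a *ℝ y)} {y} cancel ⟩
  x *ℝ fromℕ k                       ≈⟨ ^ℝ-double-cancel {r} {h} a r²≈h ha≡1 b e c ⟩
  r ^ℝ e *ℝ fromℕ c                  ∎)
  where
  open ≈ℝ-Reasoning
  open ℚ.+-*-Solver
  x = r ^ℝ (b ℕ.+ b ℕ.+ e)
  k = a ℕ.^ b ℕ.* c
  y = x *ℝ fromℕ k
  regroup : ∀ n → seq (r *ℝ (r *ℝ x) *ℝ fromℕ (a ℕ.* k)) n ≡ seq (r *ℝ r *ℝ (fromℕ a *ℝ y)) n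
  regroup n = trans (cong (seq (r *ℝ (r *ℝ x)) n ℚ.*_) (/1-* a k))
    (solve 4 (λ r x a k → r :* (r :* x) :* (a :* k) := r :* r :* (a :* (x :* k))) refl
      (seq r n) (seq x n) (+ a ℚ./ 1) (+ k ℚ./ 1))
  cancel : ∀ n → seq (h *ℝ (fromℕ a *ℝ y)) n ≡ seq y n
  cancel n = trans (sym (ℚ.*-assoc (seq h n) (+ a ℚ./ 1) (seq y n)))
    (trans (cong (ℚ._* seq y n) (ha≡1 n)) (ℚ.*-identityˡ (seq y n)))

zpow-neg : ∀ x x>0 n → zpow x x>0 (ℤ.- + n) ≡ invℝ x x>0 ^ℝ n
zpow-neg x x>0 zero    = refl
zpow-neg x x>0 (suc n) = refl

-- Limits of probabilities

p+δ≤q⇒p≤q : ∀ {p δ q} → 0ℚ ℚ.< δ → p ℚ.+ δ ℚ.≤ q → p ℚ.≤ q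
p+δ≤q⇒p≤q {p} {δ} 0<δ le = ℚ.≤-trans
  (subst (ℚ._≤ p ℚ.+ δ) (ℚ.+-identityʳ p) (ℚ.+-monoʳ-≤ p (ℚ.<⇒≤ 0<δ))) le

-- With K = pF, the error p - Y/c equals ((rK - Y) - p(rF - c))/c. Since 0 ≤ p ≤ 1 and c ≥ δ, each
-- of the two differences contributes at most θ.
quotient-bound : ∀ {c p r F K Y δ θ} → 0ℚ ℚ.< δ → δ ℚ.≤ c → 0ℚ ℚ.≤ p → p ℚ.≤ 1ℚ → p ℚ.* F ≡ K →
  ℚ.∣ r ℚ.* F ℚ.- c ∣ ℚ.≤ δ ℚ.* θ → ℚ.∣ r ℚ.* K ℚ.- Y ∣ ℚ.≤ δ ℚ.* θ →
  ℚ.∣ p ℚ.- recip c ℚ.* Y ∣ ℚ.≤ θ ℚ.+ θ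
quotient-bound {c} {p} {r} {F} {K} {Y} {δ} {θ} 0<δ δ≤c 0≤p p≤1 refl hF hK = begin
  ℚ.∣ p ℚ.- recip c ℚ.* Y ∣
    ≡⟨ cong (λ q → ℚ.∣ q ℚ.- recip c ℚ.* Y ∣) (trans (sym (ℚ.*-identityˡ p)) (cong (ℚ._* p) (sym (*-recip 0<c)))) ⟩
  ℚ.∣ c ℚ.* recip c ℚ.* p ℚ.- recip c ℚ.* Y ∣
    ≡⟨ cong ℚ.∣_∣ (solve 6 (λ c i p r F Y → c :* i :* p :- i :* Y :=
         i :* ((r :* (p :* F) :- Y) :- p :* (r :* F :- c))) refl c (recip c) p r F Y) ⟩
  ℚ.∣ recip c ℚ.* (x ℚ.- p ℚ.* y) ∣
    ≡⟨ ℚ.∣p*q∣≡∣p∣*∣q∣ (recip c) (x ℚ.- p ℚ.* y) ⟩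
  ℚ.∣ recip c ∣ ℚ.* ℚ.∣ x ℚ.- p ℚ.* y ∣
    ≡⟨ cong (ℚ._* ℚ.∣ x ℚ.- p ℚ.* y ∣) (ℚ.0≤p⇒∣p∣≡p (ℚ.<⇒≤ (recip-pos 0<c))) ⟩
  recip c ℚ.* ℚ.∣ x ℚ.- p ℚ.* y ∣
    ≤⟨ *-mono-≤-nonNeg (ℚ.0≤∣p∣ (x ℚ.- p ℚ.* y)) (ℚ.<⇒≤ (recip-pos 0<δ)) (recip-antimono 0<δ δ≤c) x-py≤ ⟩
  recip δ ℚ.* (δ ℚ.* θ ℚ.+ δ ℚ.* θ)
    ≡⟨ solve 3 (λ i d t → i :* (d :* t :+ d :* t) := d :* (i :* (t :+ t))) refl (recip δ) δ θ ⟩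
  δ ℚ.* (recip δ ℚ.* (θ ℚ.+ θ))
    ≡⟨ *-recip-cancel (θ ℚ.+ θ) 0<δ ⟩
  θ ℚ.+ θ ∎
  where
  open ℚ.≤-Reasoning
  open ℚ.+-*-Solver
  0<c = ℚ.<-≤-trans 0<δ δ≤c
  x = r ℚ.* (p ℚ.* F) ℚ.- Y
  y = r ℚ.* F ℚ.- c
  py≤ : ℚ.∣ p ℚ.* y ∣ ℚ.≤ δ ℚ.* θ
  py≤ = begin
    ℚ.∣ p ℚ.* y ∣           ≡⟨ ℚ.∣p*q∣≡∣p∣*∣q∣ p y ⟩
    ℚ.∣ p ∣ ℚ.* ℚ.∣ y ∣     ≡⟨ cong (ℚ._* ℚ.∣ y ∣) (ℚ.0≤p⇒∣p∣≡p 0≤p) ⟩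
    p ℚ.* ℚ.∣ y ∣           ≤⟨ *-mono-≤-nonNeg (ℚ.0≤∣p∣ y) (ℚ.<⇒≤ 0<1) p≤1 hF ⟩
    1ℚ ℚ.* (δ ℚ.* θ)        ≡⟨ ℚ.*-identityˡ (δ ℚ.* θ) ⟩
    δ ℚ.* θ                 ∎
  x-py≤ : ℚ.∣ x ℚ.- p ℚ.* y ∣ ℚ.≤ δ ℚ.* θ ℚ.+ δ ℚ.* θ
  x-py≤ = ℚ.≤-trans (ℚ.∣p-q∣≤∣p∣+∣q∣ x (p ℚ.* y)) (ℚ.+-mono-≤ hK py≤)

-- Since ℙ · scaledFr = 2^(-f/2) · #, the limit of ℙ is that of the right-hand side over C.
Lim-ℙ : ∀ {E C} → 0ℝ <ℝ C → Lim E scaledFr C → ∀ {z Y L} →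
  (∀ n → seq L n ≡ recip (seq C n) ℚ.* seq Y n) →
  ∀ N → (∀ f → N ℕ.≤ f → E f → 2^[ ℤ.- + f /2] *ℝ fromℕ (#[f-2m≡ z ] f) ≈ℝ Y) →
  Lim E ℙ[f-2m≡ z ] L
Lim-ℙ {E} {C} (δ , 0<δ , N₀ , δ≤C) lim {z} {Y} {L} L≡ N # ε 0<ε = N ℕ.⊔ N₁ , bound
  where
  -- Two errors θ = ε/4 add up to ε/2; the other ε/2 is the margin that `<ℝ` demands.
  θ  = ½ ℚ.* (½ ℚ.* ε)
  0<δθ : 0ℚ ℚ.< δ ℚ.* θ
  0<δθ = *-pos 0<δ (0<½* (0<½* 0<ε))
  N₁ = proj₁ (lim (δ ℚ.* θ) 0<δθ)
  bound : ∀ f → N ℕ.⊔ N₁ ℕ.≤ f → E f → ∣ ℙ[f-2m≡ z ] f -ℝ L ∣ℝ <ℝ fromℚ ε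
  bound f f≥ Ef =
    let (η , 0<η , N₂ , h₂) = proj₂ (lim (δ ℚ.* θ) 0<δθ) f (≤⊔ʳ {N} f≥) Ef
        (N₃ , h₃) = # f (≤⊔ˡ f≥) Ef (δ ℚ.* θ) 0<δθ
        P? = λ Λ → + f ℤ.- + 2 * + multiplicity Λ ℤ.≟ z
        Λs = withFrobenius f
    -- Here n indexes the rational approximations at a fixed f, so its threshold may depend on f.
    in ½ ℚ.* ε , 0<½* 0<ε , N₀ ℕ.⊔ (N₂ ℕ.⊔ N₃) , λ n n≥ →
      let n≥′ = ≤⊔ʳ {N₀} n≥
          r   = seq 2^[ ℤ.- + f /2] n
      in ℚ.≤-trans (ℚ.+-monoˡ-≤ (½ ℚ.* ε)
           (subst (λ q → ℚ.∣ uniformℙ Λs P? ℚ.- q ∣ ℚ.≤ _) (sym (L≡ n))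
             (quotient-bound {r = r} {F = + Fr f ℚ./ 1} 0<δ
               (subst (ℚ._≤ seq C n) (ℚ.+-identityˡ δ) (δ≤C n (≤⊔ˡ n≥)))
               (0≤uniformℙ P? Λs) (uniformℙ≤1 P? Λs) (uniformℙ-*-length P? Λs)
               (p+δ≤q⇒p≤q 0<η (h₂ n (≤⊔ˡ n≥′)))
               (ℚ.<⇒≤ (h₃ n (≤⊔ʳ {N₂} n≥′))))))
         (ℚ.≤-reflexive (trans (cong (ℚ._+ ½ ℚ.* ε) (½*+½* (½ ℚ.* ε))) (½*+½* ε)))

-- When b grows with f and e, c stay fixed, the right-hand side is constant: the scaled count is
-- then eventually equal to its limit.
scaled-# : ∀ {z} f b e c → f ≡ b ℕ.+ b ℕ.+ e → #[f-2m≡ z ] f ≡ 2 ℕ.^ b ℕ.* c →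
  2^[ ℤ.- + f /2] *ℝ fromℕ (#[f-2m≡ z ] f) ≈ℝ 2^[ ℤ.- + e /2] *ℝ fromℕ c
scaled-# f b e c f≡ #≡ = subst₂ _≈ℝ_
  (cong₂ (λ x k → x *ℝ fromℕ k) (trans (cong (1/√2 ^ℝ_) (sym f≡)) (sym (zpow-neg √2 √2>0 f))) (sym #≡))
  (cong (_*ℝ fromℕ c) (sym (zpow-neg √2 √2>0 e)))
  (^ℝ-double-cancel {1/√2} {½ℝ} 2 1/√2*1/√2≈½ (λ _ → refl) b e c)

2^[-2d/2]≈2^-d : ∀ d → 2^[ ℤ.- + (d ℕ.+ d) /2] ≈ℝ 2^ (ℤ.- + d)
2^[-2d/2]≈2^-d d = subst₂ _≈ℝ_ (sym (zpow-neg √2 √2>0 (d ℕ.+ d))) (sym (zpow-neg 2ℝ 2>0 d))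
  (^ℝ-double {1/√2} {½ℝ} 1/√2*1/√2≈½ d)

scaled-#-even : ∀ {z} f b d c → f ≡ b ℕ.+ b ℕ.+ (d ℕ.+ d) → #[f-2m≡ z ] f ≡ 2 ℕ.^ b ℕ.* c →
  2^[ ℤ.- + f /2] *ℝ fromℕ (#[f-2m≡ z ] f) ≈ℝ 2^ (ℤ.- + d) *ℝ fromℕ c
scaled-#-even {z} f b d c f≡ #≡ =
  ≈ℝ-trans {2^[ ℤ.- + f /2] *ℝ fromℕ (#[f-2m≡ z ] f)} {2^[ ℤ.- + (d ℕ.+ d) /2] *ℝ fromℕ c} {2^ (ℤ.- + d) *ℝ fromℕ c}
    (scaled-# f b (d ℕ.+ d) c f≡ #≡)
    (*ℝ-congʳ (fromℕ c) {2^[ ℤ.- + (d ℕ.+ d) /2]} {2^ (ℤ.- + d)} (2^[-2d/2]≈2^-d d))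

-- Expressing f by the number of free bits

f+j≡2m⇒f-2m≡-j : ∀ {f j m} → f ℕ.+ j ≡ 2 ℕ.* m → + f ℤ.- + 2 * + m ≡ ℤ.- + j
f+j≡2m⇒f-2m≡-j {f} {j} {m} eq = trans
  (cong (λ i → + f ℤ.- i) (trans (sym (ℤ.pos-* 2 m)) (cong +_ (sym eq))))
  (solve 2 (λ f j → f :- (f :+ j) := :- j) refl (+ f) (+ j))
  where open ℤ.+-*-Solver

f≡2m+j⇒f-2m≡j : ∀ {f j m} → f ≡ m ℕ.+ m ℕ.+ j → + f ℤ.- + 2 * + m ≡ + j
f≡2m+j⇒f-2m≡j {j = j} {m} refl =
  solve 2 (λ m j → m :+ m :+ j :- con (+ 2) :* m := j) refl (+ m) (+ j)
  where open ℤ.+-*-Solver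

even-excess : ∀ {f} d → 2 ℕ.* d ℕ.≤ f → Even f → ∃ λ b → f ≡ 2 ℕ.* (d ℕ.+ b)
even-excess d le (g , refl) = g ℕ.∸ d , cong (2 ℕ.*_) {g} (sym (ℕ.m+[n∸m]≡n (ℕ.*-cancelˡ-≤ {d} {g} 2 le)))

odd-excess : ∀ {f} d → 2 ℕ.* d ℕ.+ 1 ℕ.≤ f → Odd f → ∃ λ b → f ≡ 2 ℕ.* (d ℕ.+ b) ℕ.+ 1
odd-excess d le (g , refl) = let (b , eq) = even-excess d (ℕ.+-cancelʳ-≤ 1 _ _ le) (g , refl) in b , cong (ℕ._+ 1) eq

module _ {E : ℕ → Set} {C : ℝ} (C>0 : 0ℝ <ℝ C) (lim : Lim E scaledFr C) where

  Lim-ℙ-* : ∀ {z} W c N → (∀ f → N ℕ.≤ f → E f → 2^[ ℤ.- + f /2] *ℝ fromℕ (#[f-2m≡ z ] f) ≈ℝ W *ℝ fromℕ c) →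
    Lim E ℙ[f-2m≡ z ] (invℝ C C>0 *ℝ W *ℝ fromℕ c)
  Lim-ℙ-* W c N = Lim-ℙ {E} {C} C>0 lim {Y = W *ℝ fromℕ c} {L = invℝ C C>0 *ℝ W *ℝ fromℕ c}
    (λ n → ℚ.*-assoc (recip (seq C n)) (seq W n) (+ c ℚ./ 1)) N

  Lim-ℙ-1 : ∀ {z} W N → (∀ f → N ℕ.≤ f → E f → 2^[ ℤ.- + f /2] *ℝ fromℕ (#[f-2m≡ z ] f) ≈ℝ W *ℝ fromℕ 1) →
    Lim E ℙ[f-2m≡ z ] (invℝ C C>0 *ℝ W)
  Lim-ℙ-1 W N = Lim-ℙ {E} {C} C>0 lim {Y = W *ℝ fromℕ 1} {L = invℝ C C>0 *ℝ W}
    (λ n → cong (recip (seq C n) ℚ.*_) (sym (ℚ.*-identityʳ (seq W n)))) N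

-- The limits for each sign of k

Lim-even : ∀ {C} (C>0 : 0ℝ <ℝ C) → Lim Even scaledFr C → ∀ k → Lim Even ℙ[f-2m≡ + 2 * k ] (evenLimit C C>0 k)
Lim-even {C} C>0 lim k@(-[1+ n ]) = subst (λ i → Lim Even ℙ[f-2m≡ + 2 * k ] (invℝ C C>0 *ℝ 2^ i)) exponent
  (Lim-ℙ-1 {Even} {C} C>0 lim (2^ (ℤ.- + d)) (2 ℕ.* d) λ f f≥ even →
    -- Here f = 2(d + b), the multiplicity is d + b + n + 1 and b bits are free. What remains of
    -- 2^(-f/2) is 2^(-d), with d = n + 2 = 1 - k.
    let (b , f≡) = even-excess d f≥ even in
    scaled-#-even f b d 1 (trans f≡ (solve 2 (λ d b → con 2 :* (d :+ b) := b :+ b :+ (d :+ d)) refl d b))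
      (trans (#[f<2m] {d ℕ.+ b ℕ.+ n} b
          (ℕ.≤-trans (s≤s (ℕ.m≤n+m b (suc n))) (ℕ.m≤m+n (d ℕ.+ b) n))
          (trans f≡ (solve 2 (λ n b → con 2 :* (con 2 :+ n :+ b) := con 1 :+ (con 2 :+ n :+ b :+ n) :+ (con 1 :+ b)) refl n b))
          (trans (f+j≡2m⇒f-2m≡-j {f} {2 ℕ.* suc n} {suc (d ℕ.+ b ℕ.+ n)} (trans (cong (ℕ._+ 2 ℕ.* suc n) f≡)
            (solve 2 (λ n b → con 2 :* (con 2 :+ n :+ b) :+ con 2 :* (con 1 :+ n) :=
              con 2 :* (con 1 :+ (con 2 :+ n :+ b :+ n))) refl n b))) difference))
        (sym (ℕ.*-identityʳ (2 ℕ.^ b)))))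
  where
  open ℕ.+-*-Solver
  d = 2 ℕ.+ n
  exponent : ℤ.- + d ≡ k ℤ.- + 1
  exponent = cong (λ m → -[1+ suc m ]) (sym (ℕ.+-identityʳ n))
  difference : ℤ.- + (2 ℕ.* suc n) ≡ + 2 * k
  difference = refl
Lim-even {C} C>0 lim (+ zero) = Lim-ℙ {Even} {C} C>0 lim {Y = 0ℝ} {L = 0ℝ}
  (λ n → sym (ℚ.*-zeroʳ (recip (seq C n)))) 0
  λ f _ _ → pointwise⇒≈ {2^[ ℤ.- + f /2] *ℝ fromℕ (#[f-2m≡ + 0 ] f)} {0ℝ}
    λ n → trans (cong (λ k → seq 2^[ ℤ.- + f /2] n ℚ.* (+ k ℚ./ 1)) (#[f=2m] f)) (ℚ.*-zeroʳ (seq 2^[ ℤ.- + f /2] n))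
Lim-even {C} C>0 lim k@(+ suc n) = subst (λ i → Lim Even ℙ[f-2m≡ + 2 * k ] (invℝ C C>0 *ℝ 2^ i *ℝ fromℕ (S j))) exponent
  (Lim-ℙ-* {Even} {C} C>0 lim (2^ (ℤ.- + d)) (S j) (2 ℕ.* d) λ f f≥ even →
    -- Here d = 3k + 1 and j = 2k; the multiplicity j + b + 1 leaves b free bits and gives f = 2(d +
    -- b).
    let (b , f≡) = even-excess d f≥ even
        f≡2m+j = trans f≡ (solve 2 (λ n b → con 2 :* (con 3 :* n :+ con 4 :+ b) :=
          let j = con 2 :* (con 1 :+ n) ; m = con 1 :+ (j :+ b) in m :+ m :+ j) refl n b)
    in scaled-#-even f b d (S j) (trans f≡ (solve 2 (λ d b → con 2 :* (d :+ b) := b :+ b :+ (d :+ d)) refl d b))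
      (#[f>2m] {j ℕ.+ b} j b refl f≡2m+j
        (trans (f≡2m+j⇒f-2m≡j {m = suc (j ℕ.+ b)} f≡2m+j) (ℤ.pos-* 2 (suc n)))))
  where
  open ℕ.+-*-Solver
  d = 3 ℕ.* n ℕ.+ 4
  j = 2 ℕ.* suc n
  exponent : ℤ.- + d ≡ ℤ.- (+ 3 * k) ℤ.- + 1
  exponent = trans (cong (λ i → ℤ.- (i + + 4)) (ℤ.pos-* 3 n))
    (ℤ.+-*-Solver.solve 1 (λ n → S.:- (S.con (+ 3) S.:* n S.:+ S.con (+ 4)) S.:=
      S.:- (S.con (+ 3) S.:* (S.con (+ 1) S.:+ n)) S.:- S.con (+ 1)) refl (+ n))
    where module S = ℤ.+-*-Solver

Lim-odd : ∀ {C} (C>0 : 0ℝ <ℝ C) → Lim Odd scaledFr C → ∀ k → Lim Odd ℙ[f-2m≡ + 2 * k + + 1 ] (oddLimit C C>0 k)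
Lim-odd {C} C>0 lim k@(-[1+ n ]) = subst (λ i → Lim Odd ℙ[f-2m≡ + 2 * k + + 1 ] (invℝ C C>0 *ℝ 2^[ i /2])) exponent
  (Lim-ℙ-1 {Odd} {C} C>0 lim 2^[ ℤ.- + e /2] (2 ℕ.* suc n ℕ.+ 1) λ f f≥ odd →
    -- Here f = 2b + e with e = 2n + 3 = 1 - 2k, and the multiplicity is 2n + b + 2.
    let (b , f≡) = odd-excess (suc n) f≥ odd in
    scaled-# f b e 1 (trans f≡ (solve 2 (λ n b → con 2 :* (con 1 :+ n :+ b) :+ con 1 := b :+ b :+ (con 2 :* n :+ con 3)) refl n b))
      (trans (#[f<2m] {suc n ℕ.+ b ℕ.+ n} b
          (ℕ.≤-trans (s≤s (ℕ.m≤n+m b n)) (ℕ.m≤m+n (suc n ℕ.+ b) n))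
          (trans f≡ (solve 2 (λ n b → con 2 :* (con 1 :+ n :+ b) :+ con 1 := con 1 :+ (con 1 :+ n :+ b :+ n) :+ (con 1 :+ b)) refl n b))
          (trans (f+j≡2m⇒f-2m≡-j {f} {2 ℕ.* n ℕ.+ 1} {suc (suc n ℕ.+ b ℕ.+ n)} (trans (cong (ℕ._+ (2 ℕ.* n ℕ.+ 1)) f≡)
            (solve 2 (λ n b → con 2 :* (con 1 :+ n :+ b) :+ con 1 :+ (con 2 :* n :+ con 1) :=
              con 2 :* (con 1 :+ (con 1 :+ n :+ b :+ n))) refl n b))) difference))
        (sym (ℕ.*-identityʳ (2 ℕ.^ b)))))
  where
  open ℕ.+-*-Solver
  module S = ℤ.+-*-Solver
  e = 2 ℕ.* n ℕ.+ 3
  exponent : ℤ.- + e ≡ + 2 * k ℤ.- + 1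
  exponent = trans (cong (λ i → ℤ.- (i + + 3)) (ℤ.pos-* 2 n))
    (S.solve 1 (λ n → S.:- (S.con (+ 2) S.:* n S.:+ S.con (+ 3)) S.:=
      S.con (+ 2) S.:* (S.:- (S.con (+ 1) S.:+ n)) S.:- S.con (+ 1)) refl (+ n))
  difference : ℤ.- + (2 ℕ.* n ℕ.+ 1) ≡ + 2 * k + + 1
  difference = trans (cong (λ i → ℤ.- (i + + 1)) (ℤ.pos-* 2 n))
    (S.solve 1 (λ n → S.:- (S.con (+ 2) S.:* n S.:+ S.con (+ 1)) S.:=
      S.con (+ 2) S.:* (S.:- (S.con (+ 1) S.:+ n)) S.:+ S.con (+ 1)) refl (+ n))
Lim-odd {C} C>0 lim k@(+ n) = subst (λ i → Lim Odd ℙ[f-2m≡ + 2 * k + + 1 ] (invℝ C C>0 *ℝ 2^[ i /2] *ℝ fromℕ (S j))) exponent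
  (Lim-ℙ-* {Odd} {C} C>0 lim 2^[ ℤ.- + e /2] (S j) (2 ℕ.* d ℕ.+ 1) λ f f≥ odd →
    -- Here f = 2b + e with e = 2d + 1 = 6k + 5, and the multiplicity is j + b + 1 with j = 2k + 1.
    let (b , f≡) = odd-excess d f≥ odd
        f≡2m+j = trans f≡ (solve 2 (λ n b → con 2 :* (con 3 :* n :+ con 2 :+ b) :+ con 1 :=
          let j = con 2 :* n :+ con 1 ; m = con 1 :+ (j :+ b) in m :+ m :+ j) refl n b)
    in scaled-# f b e (S j)
      (trans f≡ (solve 2 (λ n b → con 2 :* (con 3 :* n :+ con 2 :+ b) :+ con 1 := b :+ b :+ (con 6 :* n :+ con 5)) refl n b))
      (#[f>2m] {j ℕ.+ b} j b refl f≡2m+j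
        (trans (f≡2m+j⇒f-2m≡j {m = suc (j ℕ.+ b)} f≡2m+j) (cong (_+ + 1) (ℤ.pos-* 2 n)))))
  where
  open ℕ.+-*-Solver
  d = 3 ℕ.* n ℕ.+ 2
  e = 6 ℕ.* n ℕ.+ 5
  j = 2 ℕ.* n ℕ.+ 1
  exponent : ℤ.- + e ≡ ℤ.- (+ 6 * k + + 5)
  exponent = cong (λ i → ℤ.- (i + + 5)) (ℤ.pos-* 6 n)

theorem5p1 : (C₀ C₁ : ℝ) (C₀>0 : 0ℝ <ℝ C₀) (C₁>0 : 0ℝ <ℝ C₁) →
    Lim Even scaledFr C₀ →
    Lim Odd scaledFr C₁ →
    (k : ℤ) →
    Lim Even ℙ[f-2m≡ + 2 * k ] (evenLimit C₀ C₀>0 k)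
    × Lim Odd ℙ[f-2m≡ + 2 * k + + 1 ] (oddLimit C₁ C₁>0 k)
theorem5p1 C₀ C₁ C₀>0 C₁>0 lim₀ lim₁ k = Lim-even {C₀} C₀>0 lim₀ k , Lim-odd {C₁} C₁>0 lim₁ k
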